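{- Let $G$ be an edge-optimal minimally $2$-edge-connected graph of order $n\geq 5$. Then $G$ is bipartite with partite sets the set of vertices of degree $2$ and the set of vertices of degree exceeding $2$.
   Context: Graphs are finite and may have multiple edges but no loops; the degree of a vertex counts edges with multiplicity, and the order of a graph is its number of vertices. For distinct vertices $u,v$ of a graph $G$, $\lambda_G(u,v)$ denotes the maximum number of edge-disjoint $u$--$v$ paths in $G$. The average edge-connectivity of a graph $G$ of order $n$ is $\overline{\lambda}(G)=\sum_{\{u,v\}\subseteq V(G)}\lambda_G(u,v)/\binom{n}{2}$. The edge-connectivity $\lambda(G)$ of a non-trivial graph $G$ is the smallest number of edges whose removal disconnects $G$. A graph $G$ is minimally $2$-edge-connected if $\lambda(G)=2$ and $\lambda(G-e)<2$ for every edge $e$ of $G$. A minimally $2$-edge-connected graph of order $n$ is called edge-optimal if it has maximum average edge-connectivity among all minimally $2$-edge-connected graphs of order $n$. -}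

module Defs where

open import Data.Fin using (Fin; _<?_; _≟_)
open import Data.Fin.Subset using (Subset; inside; outside; ∣_∣; ⁅_⁆)
open import Data.Integer using (+_)
open import Data.List using (List; []; _∷_; length; lookup; map; filter; sum; allFin; cartesianProduct)
open import Data.List.Membership.Propositional using (_∈_)
open import Data.List.Relation.Binary.Disjoint.Propositional using (Disjoint)
open import Data.List.Relation.Unary.Unique.Propositional using (Unique)
open import Data.Nat using (ℕ; _≤_; _<_; NonZero)
open import Data.Nat.Combinatorics using (_C_)
open import Data.Product using (Σ-syntax; ∃-syntax; _×_; _,_; uncurry)
open import Data.Rational as ℚ using (ℚ; _/_)
open import Data.Sum using (_⊎_)
open import Data.Vec using ([]; _∷_)
open import Relation.Binary.PropositionalEquality using (_≡_; _≢_)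
open import Relation.Nullary using (¬_; Dec; _⊎-dec_)

record Edge (n : ℕ) : Set where
  field
    end₁ end₂ : Fin n
    noLoop    : end₁ ≢ end₂

open Edge public

-- A multigraph with vertex set Fin n.  The two ends of an edge and the
-- positions of the edges in the list carry an order that none of the notions
-- below depends on; a repeated entry is a multiple edge.  Edges are identified
-- by their position, so that parallel edges are different edges.
Graph : ℕ → Set
Graph n = List (Edge n)

Joins : ∀ {n} → Edge n → Fin n → Fin n → Set
Joins e u v = (end₁ e ≡ u × end₂ e ≡ v) ⊎ (end₁ e ≡ v × end₂ e ≡ u)

Incident : ∀ {n} → Fin n → Edge n → Set
Incident v e = end₁ e ≡ v ⊎ end₂ e ≡ v

incident? : ∀ {n} (v : Fin n) (e : Edge n) → Dec (Incident v e)
incident? v e = (end₁ e ≟ v) ⊎-dec (end₂ e ≟ v)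

degree : ∀ {n} → Graph n → Fin n → ℕ
degree G v = length (filter (incident? v) G)

data Walk {n} (G : Graph n) : Fin n → Fin n → Set where
  stop : ∀ {u} → Walk G u u
  step : ∀ {u w v} (e : Fin (length G)) → Joins (lookup G e) u w →
         Walk G w v → Walk G u v

walkVertices : ∀ {n} {G : Graph n} {u v} → Walk G u v → List (Fin n)
walkVertices {u = u} stop         = u ∷ []
walkVertices {u = u} (step _ _ p) = u ∷ walkVertices p

walkEdges : ∀ {n} {G : Graph n} {u v} → Walk G u v → List (Fin (length G))
walkEdges stop         = []
walkEdges (step e _ p) = e ∷ walkEdges p

record Path {n} (G : Graph n) (u v : Fin n) : Set where
  field
    walk   : Walk G u v
    simple : Unique (walkVertices walk)

open Path public

-- For u ≢ v every path has an edge, so edge-disjointness already makes the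
-- k paths pairwise different.
EdgeDisjointPaths : ∀ {n} → Graph n → Fin n → Fin n → ℕ → Set
EdgeDisjointPaths G u v k =
  Σ[ P ∈ (Fin k → Path G u v) ]
    (∀ i j → i ≢ j → Disjoint (walkEdges (walk (P i))) (walkEdges (walk (P j))))

IsGreatest : (ℕ → Set) → ℕ → Set
IsGreatest Q k = Q k × (∀ j → Q j → j ≤ k)

IsLeast : (ℕ → Set) → ℕ → Set
IsLeast Q k = Q k × (∀ j → Q j → k ≤ j)

-- λ_G(u,v) = k, for distinct u and v.
LocalEdgeConnectivity : ∀ {n} → Graph n → Fin n → Fin n → ℕ → Set
LocalEdgeConnectivity G u v = IsGreatest (EdgeDisjointPaths G u v)

-- Each unordered pair {u,v} of distinct vertices is listed once, as u < v.
vertexPairs : ∀ n → List (Fin n × Fin n)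
vertexPairs n = filter (uncurry _<?_) (cartesianProduct (allFin n) (allFin n))

-- The average edge-connectivity of G is q.  It is undefined, and no q
-- qualifies, for graphs with fewer than two vertices.
record AverageEdgeConnectivity {n} (G : Graph n) (q : ℚ) : Set where
  field
    {{pairsNonZero}} : NonZero (n C 2)
    local            : Fin n → Fin n → ℕ
    isLocal          : ∀ u v → u ≢ v → LocalEdgeConnectivity G u v (local u v)
    isAverage        : q ≡ + sum (map (uncurry local) (vertexPairs n)) / (n C 2)

Connected : ∀ {n} → Graph n → Set
Connected G = ∀ u v → Path G u v

infixl 6 _∖_

_∖_ : ∀ {n} (G : Graph n) → Subset (length G) → Graph n
[]      ∖ []            = []
(e ∷ G) ∖ (inside  ∷ S) = G ∖ S
(e ∷ G) ∖ (outside ∷ S) = e ∷ (G ∖ S)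

DisconnectedByRemoving : ∀ {n} → Graph n → ℕ → Set
DisconnectedByRemoving G k =
  Σ[ S ∈ Subset (length G) ] (∣ S ∣ ≡ k × ¬ Connected (G ∖ S))

-- λ(G) = k.  No k qualifies for a graph with fewer than two vertices.
EdgeConnectivity : ∀ {n} → Graph n → ℕ → Set
EdgeConnectivity G = IsLeast (DisconnectedByRemoving G)

MinimallyTwoEdgeConnected : ∀ {n} → Graph n → Set
MinimallyTwoEdgeConnected G =
  EdgeConnectivity G 2 ×
  (∀ (e : Fin (length G)) → ∃[ k ] (EdgeConnectivity (G ∖ ⁅ e ⁆) k × k < 2))

EdgeOptimal : ∀ {n} → Graph n → Set
EdgeOptimal {n} G =
  MinimallyTwoEdgeConnected G ×
  ∃[ q ] (AverageEdgeConnectivity G q ×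
          (∀ (H : Graph n) r → MinimallyTwoEdgeConnected H →
             AverageEdgeConnectivity H r → r ℚ.≤ q))

record BipartiteWithPartiteSets {n} (G : Graph n) (A B : Fin n → Set) : Set where
  field
    covers   : ∀ v → A v ⊎ B v
    disjoint : ∀ v → ¬ (A v × B v)
    crossing : ∀ e → e ∈ G → (A (end₁ e) × B (end₂ e)) ⊎ (B (end₁ e) × A (end₂ e))

-- In an edge-optimal graph G some λ(a,b) is at least 3, as otherwise K₂,ₙ₋₂ is
-- better. Contracting an edge uv lowers the sum of the λ's by at most 2(n − 1),
-- because a 2-edge cut through uv leaves one of λ(u,a), λ(v,a) equal to 2 for every
-- a; a new vertex of degree 2 regains this amount. If the contraction left every
-- edge in a 2-edge cut, the new vertex could be joined to a and b, raising λ(a,b).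
-- Hence each edge e lies in exactly one 2-edge cut {e, f}, and f is not parallel
-- to e. Contracting e and subdividing f never lowers the sum; since it must not
-- raise it, e and f share an end u. If u had a third edge, its cut {g, h} could not
-- be centred at the other end of g, nor, after contracting e and subdividing f, at
-- u. So every edge meets its partner in a vertex of degree 2, and not in both ends.
--
-- Local edge-connectivities are handled through cuts. As the conclusion is
-- decidable, Menger's theorem is only needed up to double negation.

module Submission where

open import Defs
open import Data.Nat.Properties hiding (_≟_; _<?_)
open import Algebra.Properties.CommutativeMonoid.Sum +-0-commutativeMonoid using (∑-distrib-+; ∑-comm; sum-cong-≗; sum-replicate-zero) renaming (sum to ∑)
open import Algebra.Properties.CommutativeSemigroup +-commutativeSemigroup using (interchange; x∙yz≈y∙xz)
open import Data.Bool using (Bool; true; false; _∧_; _∨_; _xor_; if_then_else_)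
open import Data.Bool.Properties as Bool using (¬-not)
open import Data.Empty using (⊥)
open import Data.Fin using (Fin; zero; suc; _≟_; _<?_)
open import Data.Fin.Properties as Fin using (injective⇒≤) renaming (suc-injective to Fin-suc-injective)
open import Data.Fin.Subset using (Subset; inside; outside; ∣_∣; ⁅_⁆; _∪_) renaming (⊥ to ∅; _∈_ to _∈ˢ_; _∉_ to _∉ˢ_)
open import Data.Fin.Subset.Properties using (∣⁅x⁆∣≡1; x∈⁅x⁆; x∈⁅y⁆⇒x≡y; drop-there; p⊆p∪q; q⊆p∪q)
import Data.Integer as ℤ
import Data.Integer.Properties as ℤ
open import Data.List using (List; []; _∷_; _++_; length; lookup; map; filter; allFin; replicate; tabulate; cartesianProduct)
open import Data.List.Membership.Propositional using (_∈_)
open import Data.List.Membership.Propositional.Properties using (∈-map⁺; ∈-map⁻; ∈-++⁻; ∈-lookup)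
open import Data.List.Properties using (length-map; length-replicate; map-++; map-∘; map-id; map-tabulate)
open import Data.List.Relation.Binary.Disjoint.Propositional using (Disjoint)
open import Data.List.Relation.Binary.Permutation.Propositional using (_↭_; ↭-refl; ↭-sym; ↭-trans; prep; swap; ↭⇒↭ₛ)
open import Data.List.Relation.Binary.Permutation.Propositional.Properties using (map⁺; drop-∷; ∈-resp-↭; ↭-length)
import Data.List.Relation.Binary.Permutation.Setoid.Properties as PermS
open import Data.List.Relation.Unary.All as All using ([]; _∷_)
import Data.List.Relation.Unary.All.Properties as All
open import Data.List.Relation.Unary.AllPairs as AllPairs using (AllPairs; []; _∷_)
open import Data.List.Relation.Unary.Any using (here; there; index; any?)
open import Data.List.Relation.Unary.Any.Properties using (lookup-index)
open import Data.List.Relation.Unary.Unique.Propositional using (Unique)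
open import Data.Nat using (ℕ; zero; suc; _+_; _*_; _≤_; _<_; z≤n; s≤s; s≤s⁻¹; _≤?_; NonZero)
open import Data.Nat.Combinatorics using (_C_)
open import Data.Nat.ListAction using (sum)
open import Data.Nat.ListAction.Properties using (sum-++)
open import Data.Nat.Tactic.RingSolver using (solve-∀)
open import Data.Product using (Σ-syntax; ∃-syntax; _×_; _,_; proj₁; proj₂; uncurry)
open import Data.Rational as ℚ using (_/_)
import Data.Rational.Properties as ℚ
import Data.Rational.Unnormalised as ℚᵘ
import Data.Rational.Unnormalised.Properties as ℚᵘ
open import Data.Sum using (_⊎_; inj₁; inj₂; [_,_]′)
import Data.Vec as Vec
open import Function using (_∘_; id; case_of_)
open import Relation.Binary.Definitions using (tri<; tri≈; tri>)
open import Relation.Binary.PropositionalEquality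
open import Relation.Nullary using (¬_; ¬?; Dec; yes; no; contradiction; does)
open import Relation.Nullary.Decidable using (decidable-stable; ¬¬-excluded-middle; dec-true; dec-false)

-- Cuts and Menger's theorem

-- Contracting uv would change the order of the graph. Therefore `v` keeps its name and returns as
-- the new vertex of degree 2: all graphs live on `Fin n`, and their local connectivities can be
-- compared entry by entry, except that at `u` and `v` only sums are controlled. A move that loses
-- nothing in total yields another optimal graph. What has been shown for `G` thus holds in the
-- modified graph as well, and two moves can follow each other; the exclusion of two partner pairs
-- at one vertex depends on this. Once partners are known, gains come from the destruction of a cut:
-- contracting e removes exactly the cuts that separate its ends, among them {e, f}. If {e, f} was
-- the only 2-edge cut between two vertices away from e, their connectivity rises from 2 to at least
-- 3. The bound n ≥ 5 provides n - 2 ≥ 3 paths between the hubs of the comparison graph. For n = 4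
-- that graph is the 4-cycle, where all degrees and all local connectivities are 2.

Cut : ℕ → Set
Cut n = Fin n → Bool

sep : Bool → Bool → ℕ
sep true  true  = 0
sep true  false = 1
sep false true  = 1
sep false false = 0

sep-≡ : ∀ {x y} → x ≡ y → sep x y ≡ 0
sep-≡ {true}  refl = refl
sep-≡ {false} refl = refl

sep-≢ : ∀ {x y} → x ≢ y → sep x y ≡ 1
sep-≢ {true}  {true}  n = contradiction refl n
sep-≢ {true}  {false} n = refl
sep-≢ {false} {true}  n = refl
sep-≢ {false} {false} n = contradiction refl n

sep-comm : ∀ x y → sep x y ≡ sep y x
sep-comm true  true  = refl
sep-comm true  false = refl
sep-comm false true  = refl
sep-comm false false = refl

sep≤1 : ∀ x y → sep x y ≤ 1
sep≤1 true  true  = z≤n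
sep≤1 true  false = ≤-refl
sep≤1 false true  = ≤-refl
sep≤1 false false = z≤n

sep-triangle : ∀ x y z → sep x z ≤ sep x y + sep z y
sep-triangle true  true  true  = z≤n
sep-triangle true  true  false = ≤-refl
sep-triangle true  false true  = z≤n
sep-triangle true  false false = ≤-refl
sep-triangle false true  true  = ≤-refl
sep-triangle false true  false = z≤n
sep-triangle false false true  = ≤-refl
sep-triangle false false false = ≤-refl

separation : ∀ {n} → Cut n → Edge n → ℕ
separation X e = sep (X (end₁ e)) (X (end₂ e))

cutSize : ∀ {n} → Graph n → Cut n → ℕ
cutSize []      X = 0
cutSize (e ∷ G) X = separation X e + cutSize G X

Crosses : ∀ {n} → Cut n → Edge n → Set
Crosses X e = X (end₁ e) ≢ X (end₂ e)

crosses? : ∀ {n} (X : Cut n) (e : Edge n) → Dec (Crosses X e)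
crosses? X e = ¬? (X (end₁ e) Bool.≟ X (end₂ e))

-- By Menger's theorem this says λ(a,b) ≥ k.
EdgeConnected : ∀ {n} → Graph n → ℕ → Fin n → Fin n → Set
EdgeConnected G k a b = ∀ X → X a ≢ X b → k ≤ cutSize G X

bit : Bool → ℕ
bit true  = 1
bit false = 0

count : ∀ {n} → Cut n → List (Fin n) → ℕ
count X A = sum (map (bit ∘ X) A)

cutSize-submodular : ∀ {n} (G : Graph n) (X Z : Cut n) →
  cutSize G (λ v → X v ∧ Z v) + cutSize G (λ v → X v ∨ Z v) ≤ cutSize G X + cutSize G Z
cutSize-submodular []      X Z = z≤n
cutSize-submodular (e ∷ G) X Z = begin
  (s∩ + d∩) + (s∪ + d∪)  ≡⟨ interchange s∩ d∩ s∪ d∪ ⟩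
  (s∩ + s∪) + (d∩ + d∪)  ≤⟨ +-mono-≤ (edge (X (end₁ e)) (X (end₂ e)) (Z (end₁ e)) (Z (end₂ e))) (cutSize-submodular G X Z) ⟩
  (sX + sZ) + (dX + dZ)  ≡⟨ interchange sX sZ dX dZ ⟩
  (sX + dX) + (sZ + dZ)  ∎
  where
  open ≤-Reasoning
  s∩ = separation (λ v → X v ∧ Z v) e
  s∪ = separation (λ v → X v ∨ Z v) e
  d∩ = cutSize G (λ v → X v ∧ Z v)
  d∪ = cutSize G (λ v → X v ∨ Z v)
  sX = separation X e
  sZ = separation Z e
  dX = cutSize G X
  dZ = cutSize G Z
  edge : ∀ x y z w → sep (x ∧ z) (y ∧ w) + sep (x ∨ z) (y ∨ w) ≤ sep x y + sep z w
  edge true  true  z     w     = ≤-reflexive (+-identityʳ _)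
  edge false false z     w     = ≤-refl
  edge true  false true  true  = ≤-refl
  edge true  false true  false = ≤-refl
  edge true  false false true  = z≤n
  edge true  false false false = ≤-refl
  edge false true  true  true  = ≤-refl
  edge false true  true  false = z≤n
  edge false true  false true  = ≤-refl
  edge false true  false false = ≤-refl

count-modular : ∀ {n} (A : List (Fin n)) (X Z : Cut n) →
  count X A + count Z A ≡ count (λ v → X v ∧ Z v) A + count (λ v → X v ∨ Z v) A
count-modular []      X Z = refl
count-modular (a ∷ A) X Z = begin
  (bit (X a) + count X A) + (bit (Z a) + count Z A)  ≡⟨ interchange (bit (X a)) _ _ _ ⟩
  (bit (X a) + bit (Z a)) + (count X A + count Z A)  ≡⟨ cong₂ _+_ (vertex (X a) (Z a)) (count-modular A X Z) ⟩
  (bit (X a ∧ Z a) + bit (X a ∨ Z a)) + (count X∩Z A + count X∪Z A)  ≡⟨ interchange (bit (X a ∧ Z a)) _ _ _ ⟩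
  (bit (X a ∧ Z a) + count X∩Z A) + (bit (X a ∨ Z a) + count X∪Z A)  ∎
  where
  open ≡-Reasoning
  X∩Z = λ v → X v ∧ Z v
  X∪Z = λ v → X v ∨ Z v
  vertex : ∀ x z → bit x + bit z ≡ bit (x ∧ z) + bit (x ∨ z)
  vertex true  true  = refl
  vertex true  false = refl
  vertex false true  = refl
  vertex false false = refl

-- The cut condition for routing one walk from each source in A to the sinks B.
Routable : ∀ {n} → Graph n → List (Fin n) → List (Fin n) → Set
Routable G A B = ∀ X → count X A ≤ count X B + cutSize G X

¬∀⇒¬¬∃ : {A : Set} {f g : A → ℕ} → ¬ (∀ x → f x ≤ g x) → ¬ ¬ (∃[ x ] g x < f x)
¬∀⇒¬¬∃ {f = f} {g} ¬all none = ¬all λ x → case f x ≤? g x of λ where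
  (yes p) → p
  (no ¬p) → contradiction (x , ≰⇒> ¬p) none

-- If no cut forbids e to stay unused, nothing is to be shown; otherwise a cut X
-- saturated by e forces its direction, and a cut Z forbidding that direction
-- violates the cut condition at X ∩ Z or X ∪ Z.
saturated-direction : ∀ {n} (e : Edge n) (G : Graph n) {A B} → Routable (e ∷ G) A B →
  ∀ {u v} → (∀ Y → separation Y e ≡ sep (Y u) (Y v)) →
  ∀ X → X u ≡ true → X v ≡ false → count X B + cutSize G X < count X A →
  Routable G (v ∷ A) (u ∷ B)
saturated-direction e G {A} {B} r {u} {v} e≈uv X Xu Xv sat Z = ≮⇒≥ λ bad → <-irrefl refl (begin-strict
  2 + (BX + dX + (bit (Z u) + BZ + dZ))
    ≡⟨ sym (cong suc (+-suc (BX + dX) _)) ⟩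
  suc (BX + dX) + suc (bit (Z u) + BZ + dZ)
    ≤⟨ +-mono-≤ sat bad ⟩
  AX + (bit (Z v) + AZ)
    ≡⟨ x∙yz≈y∙xz AX (bit (Z v)) AZ ⟩
  bit (Z v) + (AX + AZ)
    ≡⟨ cong (bit (Z v) +_) (count-modular A X Z) ⟩
  bit (Z v) + (A∩ + A∪)
    ≤⟨ +-monoʳ-≤ (bit (Z v)) (+-mono-≤ (r X∩Z) (r X∪Z)) ⟩
  bit (Z v) + ((B∩ + (s∩ + d∩)) + (B∪ + (s∪ + d∪)))
    ≡⟨ regroup (bit (Z v)) B∩ s∩ d∩ B∪ s∪ d∪ ⟩
  (bit (Z v) + s∩ + s∪) + ((B∩ + B∪) + (d∩ + d∪))
    ≤⟨ +-mono-≤ (≤-reflexive bits) (+-mono-≤ (≤-reflexive (sym (count-modular B X Z))) (cutSize-submodular G X Z)) ⟩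
  suc (bit (Z u)) + ((BX + BZ) + (dX + dZ))
    ≡⟨ regroup′ (bit (Z u)) BX BZ dX dZ ⟩
  1 + (BX + dX + (bit (Z u) + BZ + dZ))
    <⟨ n<1+n _ ⟩
  2 + (BX + dX + (bit (Z u) + BZ + dZ)) ∎)
  where
  open ≤-Reasoning
  X∩Z = λ w → X w ∧ Z w
  X∪Z = λ w → X w ∨ Z w
  AX = count X A
  AZ = count Z A
  BX = count X B
  BZ = count Z B
  dX = cutSize G X
  dZ = cutSize G Z
  A∩ = count X∩Z A
  A∪ = count X∪Z A
  B∩ = count X∩Z B
  B∪ = count X∪Z B
  d∩ = cutSize G X∩Z
  d∪ = cutSize G X∪Z
  s∩ = separation X∩Z e
  s∪ = separation X∪Z e
  regroup : ∀ z a b c d e f → z + ((a + (b + c)) + (d + (e + f))) ≡ (z + b + e) + ((a + d) + (c + f))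
  regroup = solve-∀
  regroup′ : ∀ z a b c d → suc z + ((a + b) + (c + d)) ≡ 1 + (a + c + (z + b + d))
  regroup′ = solve-∀
  -- As `X` contains `u` but not `v`, the edge adds `bit (Z u)` to the cut of X ∩ Z and 1 -
  -- `bit (Z v)` to that of X ∪ Z. It thus contributes only 1 to the balance, while the strict
  -- inequalities at `X` and `Z` claim 2.
  bits : bit (Z v) + s∩ + s∪ ≡ suc (bit (Z u))
  bits rewrite e≈uv X∩Z | e≈uv X∪Z | Xu | Xv with Z u | Z v
  ... | true  | true  = refl
  ... | true  | false = refl
  ... | false | true  = refl
  ... | false | false = refl

module _ {n} {G : Graph n} where

  _++ʷ_ : ∀ {u v w} → Walk G u v → Walk G v w → Walk G u w
  stop        ++ʷ q = q
  step e j p  ++ʷ q = step e j (p ++ʷ q)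

  walkEdges-++ʷ : ∀ {u v w} (p : Walk G u v) (q : Walk G v w) →
                  walkEdges (p ++ʷ q) ≡ walkEdges p ++ walkEdges q
  walkEdges-++ʷ stop         q = refl
  walkEdges-++ʷ (step e j p) q = cong (e ∷_) (walkEdges-++ʷ p q)

  weaken : ∀ e {u v} → Walk G u v → Walk (e ∷ G) u v
  weaken e stop         = stop
  weaken e (step i j p) = step (suc i) j (weaken e p)

  walkEdges-weaken : ∀ e {u v} (p : Walk G u v) → walkEdges (weaken e p) ≡ map suc (walkEdges p)
  walkEdges-weaken e stop         = refl
  walkEdges-weaken e (step i j p) = cong (suc i ∷_) (walkEdges-weaken e p)

  AnyWalk : Set
  AnyWalk = Σ[ u ∈ Fin n ] Σ[ v ∈ Fin n ] Walk G u v

  edgesOf : AnyWalk → List (Fin (length G))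
  edgesOf = walkEdges ∘ proj₂ ∘ proj₂

DisjointWalks : ∀ {n} {G : Graph n} → AnyWalk {G = G} → AnyWalk {G = G} → Set
DisjointWalks P Q = Disjoint (edgesOf P) (edgesOf Q)

-- Sources and sinks are multisets without a prescribed matching, because the induction over the
-- edges cannot control which source is linked to which sink. Walks may repeat vertices, as joining
-- two of them through an edge can create repetitions.
record Linkage {n} (G : Graph n) (A B : List (Fin n)) : Set where
  field
    walks    : List (AnyWalk {G = G})
    sources  : map proj₁ walks ↭ A
    sinks    : map (proj₁ ∘ proj₂) walks ↭ B
    disjoint : AllPairs DisjointWalks walks

map-∈⇒↭ : {A B : Set} (f : A → B) {y : B} {xs : List A} → y ∈ map f xs →
          ∃[ x ] ∃[ xs′ ] (f x ≡ y × xs ↭ x ∷ xs′)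
map-∈⇒↭ f {xs = x ∷ xs} (here y≡) = x , xs , sym y≡ , ↭-refl
map-∈⇒↭ f {xs = x ∷ xs} (there y∈) with map-∈⇒↭ f y∈
... | z , xs′ , fz≡y , p = z , x ∷ xs′ , fz≡y , ↭-trans (prep x p) (swap x z ↭-refl)

weakenAny : ∀ {n} {G : Graph n} e → AnyWalk {G = G} → AnyWalk {G = e ∷ G}
weakenAny e (u , v , p) = u , v , weaken e p

sources-weaken : ∀ {n} {G : Graph n} e (L : List (AnyWalk {G = G})) →
                 map proj₁ (map (weakenAny e) L) ≡ map proj₁ L
sources-weaken e []      = refl
sources-weaken e (P ∷ L) = cong (_ ∷_) (sources-weaken e L)

sinks-weaken : ∀ {n} {G : Graph n} e (L : List (AnyWalk {G = G})) →
               map (proj₁ ∘ proj₂) (map (weakenAny e) L) ≡ map (proj₁ ∘ proj₂) L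
sinks-weaken e []      = refl
sinks-weaken e (P ∷ L) = cong (_ ∷_) (sinks-weaken e L)

disjoint-weaken : ∀ {n} {G : Graph n} e (L : List (AnyWalk {G = G})) →
  AllPairs DisjointWalks L → AllPairs DisjointWalks (map (weakenAny e) L)
disjoint-weaken e []      []       = []
disjoint-weaken e (P ∷ L) (d ∷ ds) =
  All.map⁺ (All.map (λ {Q} → dis {Q}) d) ∷ disjoint-weaken e L ds
  where
  dis : ∀ {Q} → DisjointWalks P Q → DisjointWalks (weakenAny e P) (weakenAny e Q)
  dis {Q} dPQ (i∈P , i∈Q)
    with ∈-map⁻ suc (subst (_ ∈_) (walkEdges-weaken e (proj₂ (proj₂ P))) i∈P)
       | ∈-map⁻ suc (subst (_ ∈_) (walkEdges-weaken e (proj₂ (proj₂ Q))) i∈Q)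
  ... | k , k∈ , refl | l , l∈ , eq = dPQ (k∈ , subst (_∈ edgesOf Q) (sym (Fin-suc-injective eq)) l∈)

linkage-skip : ∀ {n} {G : Graph n} e {A B} → Linkage G A B → Linkage (e ∷ G) A B
linkage-skip e K = record
  { walks    = map (weakenAny e) walks
  ; sources  = subst (_↭ _) (sym (sources-weaken e walks)) sources
  ; sinks    = subst (_↭ _) (sym (sinks-weaken e walks)) sinks
  ; disjoint = disjoint-weaken e walks disjoint
  } where open Linkage K

AllPairs-↭ : ∀ {n} {G : Graph n} {L L′ : List (AnyWalk {G = G})} → L ↭ L′ →
             AllPairs DisjointWalks L → AllPairs DisjointWalks L′
AllPairs-↭ {n} {G} p = PermS.AllPairs-resp-↭ (setoid (AnyWalk {G = G})) {R = DisjointWalks}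
  (λ d {_} (x , y) → d (y , x)) ((λ where refl d → d) , (λ where refl d → d)) (↭⇒↭ₛ p)

-- The walk starting at v and the walk ending at u are joined through e; if they
-- are the same walk, it closes to a circuit with e and is dropped.
linkage-use : ∀ {n} {G : Graph n} e {A B u v} → Joins e u v →
              Linkage G (v ∷ A) (u ∷ B) → Linkage (e ∷ G) A B
linkage-use {G = G} e {A} {B} {u} {v} joins K
  with map-∈⇒↭ proj₁ (∈-resp-↭ (↭-sym (Linkage.sources K)) (here refl))
... | P@(_ , b , p) , L , refl , L↭
  with ∈-resp-↭ (↭-sym (↭-trans (↭-sym (map⁺ (proj₁ ∘ proj₂) L↭)) (Linkage.sinks K))) (here refl)
... | here refl = linkage-skip e record
  { walks    = L
  ; sources  = drop-∷ (↭-trans (↭-sym (map⁺ proj₁ L↭)) (Linkage.sources K))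
  ; sinks    = drop-∷ (↭-trans (↭-sym (map⁺ (proj₁ ∘ proj₂) L↭)) (Linkage.sinks K))
  ; disjoint = AllPairs.tail (AllPairs-↭ L↭ (Linkage.disjoint K))
  }
... | there u∈ with map-∈⇒↭ (proj₁ ∘ proj₂) u∈
... | Q@(a , _ , q) , L′ , refl , L↭′ = record
  { walks    = joined ∷ map (weakenAny e) L′
  ; sources  = ↭-trans (subst (λ l → a ∷ l ↭ a ∷ map proj₁ L′) (sym (sources-weaken e L′)) ↭-refl)
                 (drop-∷ (↭-trans (↭-sym (map⁺ proj₁ whole)) (Linkage.sources K)))
  ; sinks    = ↭-trans (subst (λ l → b ∷ l ↭ b ∷ map (proj₁ ∘ proj₂) L′) (sym (sinks-weaken e L′)) ↭-refl)
                 (drop-∷ (↭-trans (swap u b ↭-refl) (↭-trans (↭-sym (map⁺ (proj₁ ∘ proj₂) whole)) (Linkage.sinks K))))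
  ; disjoint = All.map⁺ (All.tabulate λ {R} R∈ → apart R (All.lookup (All.tail (AllPairs.head disj)) R∈)
                                                         (All.lookup (AllPairs.head (AllPairs.tail disj)) R∈))
               ∷ disjoint-weaken e L′ (AllPairs.tail (AllPairs.tail disj))
  }
  where
  whole : Linkage.walks K ↭ P ∷ Q ∷ L′
  whole = ↭-trans L↭ (prep P L↭′)
  disj : AllPairs DisjointWalks (P ∷ Q ∷ L′)
  disj = AllPairs-↭ whole (Linkage.disjoint K)
  joined : AnyWalk {G = e ∷ G}
  joined = a , b , weaken e q ++ʷ step zero joins (weaken e p)
  apart : ∀ R → DisjointWalks P R → DisjointWalks Q R → DisjointWalks joined (weakenAny e R)
  apart R dP dQ (i∈ , i∈R)
    with ∈-map⁻ suc (subst (_ ∈_) (walkEdges-weaken e (proj₂ (proj₂ R))) i∈R)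
  ... | k , k∈ , refl
    with ∈-++⁻ (walkEdges (weaken e q)) (subst (suc k ∈_) (walkEdges-++ʷ (weaken e q) _) i∈)
  ... | inj₁ i∈q with ∈-map⁻ suc (subst (_ ∈_) (walkEdges-weaken e q) i∈q)
  ...   | l , l∈ , refl = dQ (l∈ , k∈)
  apart R dP dQ (i∈ , i∈R) | k , k∈ , refl | inj₂ (there i∈p) with ∈-map⁻ suc (subst (_ ∈_) (walkEdges-weaken e p) i∈p)
  ...   | l , l∈ , refl = dP (l∈ , k∈)

⁅_⁆ᶜ : ∀ {n} → Fin n → Cut n
⁅ a ⁆ᶜ v = does (v ≟ a)

⁅⁆-separates : ∀ {n} {u v : Fin n} → u ≢ v → ⁅ u ⁆ᶜ u ≢ ⁅ u ⁆ᶜ v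
⁅⁆-separates {u = u} {v} u≢v eq = case trans (sym (dec-true (u ≟ u) refl)) (trans eq (dec-false (v ≟ u) (u≢v ∘ sym))) of λ ()

count-∈ : ∀ {n} {a : Fin n} {A} → a ∈ A → 1 ≤ count ⁅ a ⁆ᶜ A
count-∈ {a = a} (here refl) rewrite dec-true (a ≟ a) refl = s≤s z≤n
count-∈ {a = a} {A = x ∷ A} (there a∈) = m≤n⇒m≤o+n (bit (⁅ a ⁆ᶜ x)) (count-∈ a∈)

∈-count : ∀ {n} {a : Fin n} A → 1 ≤ count ⁅ a ⁆ᶜ A → a ∈ A
∈-count {a = a} (x ∷ A) 1≤ with x ≟ a
... | yes refl = here refl
... | no _     = there (∈-count A 1≤)

count-↭ : ∀ {n} {X : Cut n} {A B} → A ↭ B → count X A ≡ count X B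
count-↭ _↭_.refl           = refl
count-↭ {X = X} (prep x p) = cong (bit (X x) +_) (count-↭ p)
count-↭ {X = X} (swap {A} {B} x y p) = trans (cong (λ c → bit (X x) + (bit (X y) + c)) (count-↭ p))
                                     (x∙yz≈y∙xz (bit (X x)) (bit (X y)) _)
count-↭ (_↭_.trans p q) = trans (count-↭ p) (count-↭ q)

-- Without edges, the cut condition at the singleton of a source puts it into `B`. Removing it from
-- both lists preserves the condition, and equal lengths leave no sink over.
routable-[]⇒↭ : ∀ {n} (A B : List (Fin n)) → length A ≡ length B → Routable [] A B → A ↭ B
routable-[]⇒↭ []      []      _   _ = ↭-refl
routable-[]⇒↭ (a ∷ A) B       eq  r
  with map-∈⇒↭ id (subst (a ∈_) (sym (map-id B)) (∈-count B (≤-trans (count-∈ {A = a ∷ A} (here refl)) (subst (_ ≤_) (+-identityʳ _) (r ⁅ a ⁆ᶜ)))))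
... | _ , B′ , refl , B↭ = ↭-trans (prep a (routable-[]⇒↭ A B′ (suc-injective (trans eq (↭-length B↭)))
        λ X → +-cancelˡ-≤ (bit (X a)) _ _ (subst (bit (X a) + count X A ≤_)
                (trans (cong (_+ 0) (count-↭ B↭)) (+-assoc (bit (X a)) _ _)) (r X)))) (↭-sym B↭)

-- Induction on the edges. Sending a walk along `e` from u to v leaves in `G` one walk ending at u
-- and one starting at v, hence the extra sink u and source v. A cut that violates the condition in
-- `G` must be crossed by `e`, since `e ∷ G` satisfies it, and u is the end inside that cut.
routable⇒linkage : ∀ {n} (G : Graph n) A B → length A ≡ length B → Routable G A B → ¬ ¬ Linkage G A B
routable⇒linkage [] A B eq r k = k record
  { walks    = map (λ a → a , a , stop) A
  ; sources  = subst (_↭ A) (sym (same A)) ↭-refl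
  ; sinks    = subst (_↭ B) (sym (same′ A)) (routable-[]⇒↭ A B eq r)
  ; disjoint = dis A
  }
  where
  same : ∀ A → map proj₁ (map (λ a → a , a , stop) A) ≡ A
  same []      = refl
  same (a ∷ A) = cong (a ∷_) (same A)
  same′ : ∀ A → map (proj₁ ∘ proj₂) (map (λ a → a , a , stop) A) ≡ A
  same′ []      = refl
  same′ (a ∷ A) = cong (a ∷_) (same′ A)
  dis : ∀ A → AllPairs DisjointWalks (map (λ a → a , a , stop) A)
  dis []      = []
  dis (a ∷ A) = All.map⁺ (All.tabulate λ _ ()) ∷ dis A
routable⇒linkage {n} (e ∷ G) A B eq r k = ¬¬-excluded-middle {A = Routable G A B} λ where
    (yes r′) → routable⇒linkage G A B eq r′ (k ∘ linkage-skip e)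
    (no ¬r′) → ¬∀⇒¬¬∃ ¬r′ λ (X , sat) → cases X sat (X (end₁ e)) (X (end₂ e)) refl refl
  where
  cases : ∀ X → count X B + cutSize G X < count X A → ∀ x y → X (end₁ e) ≡ x → X (end₂ e) ≡ y → ⊥
  cases X sat true false Xu Xv = routable⇒linkage G (end₂ e ∷ A) (end₁ e ∷ B) (cong suc eq)
    (saturated-direction e G {A} {B} r (λ _ → refl) X Xu Xv sat) (k ∘ linkage-use e (inj₁ (refl , refl)))
  cases X sat false true Xu Xv = routable⇒linkage G (end₁ e ∷ A) (end₂ e ∷ B) (cong suc eq)
    (saturated-direction e G {A} {B} r (λ _ → sep-comm _ _) X Xv Xu sat) (k ∘ linkage-use e (inj₂ (refl , refl)))
  cases X sat true true Xu Xv = <⇒≱ sat (subst (count X A ≤_) (cong (λ s → count X B + (s + cutSize G X)) (sep-≡ (trans Xu (sym Xv)))) (r X))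
  cases X sat false false Xu Xv = <⇒≱ sat (subst (count X A ≤_) (cong (λ s → count X B + (s + cutSize G X)) (sep-≡ (trans Xu (sym Xv)))) (r X))

¬¬-finite : ∀ {n} {P : Fin n → Set} → (∀ i → ¬ ¬ P i) → ¬ ¬ (∀ i → P i)
¬¬-finite {zero}  f k = k λ ()
¬¬-finite {suc n} f k = f zero λ p → ¬¬-finite (f ∘ suc) λ q → k λ where
  zero    → p
  (suc i) → q i

module _ {n} {G : Graph n} where

  suffixFrom : ∀ {u v w} (p : Walk G u v) → w ∈ walkVertices p → Unique (walkVertices p) →
    Σ[ q ∈ Path G w v ] (∀ {i} → i ∈ walkEdges (walk q) → i ∈ walkEdges p)
  suffixFrom p@stop         (here refl) uniq = record { walk = p ; simple = uniq } , id
  suffixFrom p@(step _ _ _) (here refl) uniq = record { walk = p ; simple = uniq } , id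
  suffixFrom (step e j p)   (there w∈) (_ ∷ uniq) with suffixFrom p w∈ uniq
  ... | q , q⊆ = q , there ∘ q⊆

  erase-loops : ∀ {u v} (p : Walk G u v) →
    Σ[ q ∈ Path G u v ] (∀ {i} → i ∈ walkEdges (walk q) → i ∈ walkEdges p)
  erase-loops stop = record { walk = stop ; simple = [] ∷ [] } , id
  erase-loops {u} (step e j p) with erase-loops p
  ... | q , q⊆ with any? (u ≟_) (walkVertices (walk q))
  ...   | yes u∈ = let r , r⊆ = suffixFrom (walk q) u∈ (simple q) in r , there ∘ q⊆ ∘ r⊆
  ...   | no u∉  = record { walk = step e j (walk q) ; simple = All.¬Any⇒All¬ _ u∉ ∷ simple q }
                 , λ where (here refl) → here refl
                           (there i∈)  → there (q⊆ i∈)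

  crossing-step : ∀ {a b} (p : Walk G a b) (X : Cut n) → X a ≢ X b →
    ∃[ i ] (i ∈ walkEdges p × Crosses X (lookup G i))
  crossing-step stop X a≢b = contradiction refl a≢b
  crossing-step {b = b} (step e j p) X a≢b with crosses? X (lookup G e)
  ... | yes c = e , here refl , c
  ... | no ¬c = let i , i∈ , c = crossing-step p X (subst (λ x → x ≢ X b) (across j) a≢b) in i , there i∈ , c
    where
    same : X (end₁ (lookup G e)) ≡ X (end₂ (lookup G e))
    same = decidable-stable (_ Bool.≟ _) ¬c
    across : ∀ {u w} → Joins (lookup G e) u w → X u ≡ X w
    across (inj₁ (refl , refl)) = same
    across (inj₂ (refl , refl)) = sym same

crossingPositions : ∀ {n} (G : Graph n) → Cut n → List (Fin (length G))
crossingPositions []      X = []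
crossingPositions (e ∷ G) X with crosses? X e
... | yes _ = zero ∷ map suc (crossingPositions G X)
... | no _  = map suc (crossingPositions G X)

length-crossingPositions : ∀ {n} (G : Graph n) X → length (crossingPositions G X) ≡ cutSize G X
length-crossingPositions []      X = refl
length-crossingPositions (e ∷ G) X with crosses? X e
... | yes c = cong₂ _+_ (sym (sep-≢ c)) (trans (length-map suc (crossingPositions G X)) (length-crossingPositions G X))
... | no ¬c = cong₂ _+_ (sym (sep-≡ (decidable-stable (_ Bool.≟ _) ¬c)))
                        (trans (length-map suc (crossingPositions G X)) (length-crossingPositions G X))

∈-crossingPositions : ∀ {n} (G : Graph n) X i → Crosses X (lookup G i) → i ∈ crossingPositions G X
∈-crossingPositions (e ∷ G) X i c with crosses? X e
∈-crossingPositions (e ∷ G) X zero    c | yes _ = here refl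
∈-crossingPositions (e ∷ G) X (suc i) c | yes _ = there (∈-map⁺ suc (∈-crossingPositions G X i c))
∈-crossingPositions (e ∷ G) X zero    c | no ¬c = contradiction c ¬c
∈-crossingPositions (e ∷ G) X (suc i) c | no _  = ∈-map⁺ suc (∈-crossingPositions G X i c)

injection⇒≤cutSize : ∀ {n k} (G : Graph n) X (f : Fin k → Fin (length G)) →
  (∀ i j → f i ≡ f j → i ≡ j) → (∀ i → Crosses X (lookup G (f i))) → k ≤ cutSize G X
injection⇒≤cutSize {k = k} G X f inj crosses =
  subst (k ≤_) (length-crossingPositions G X) (injective⇒≤ {f = rank} rank-injective)
  where
  f∈ : ∀ i → f i ∈ crossingPositions G X
  f∈ i = ∈-crossingPositions G X (f i) (crosses i)
  rank : Fin k → Fin (length (crossingPositions G X))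
  rank i = index (f∈ i)
  rank-injective : ∀ {i j} → rank i ≡ rank j → i ≡ j
  rank-injective {i} {j} eq = inj i j (trans (lookup-index (f∈ i))
    (trans (cong (lookup (crossingPositions G X)) eq) (sym (lookup-index (f∈ j)))))

paths⇒edgeConnected : ∀ {n} {G : Graph n} {a b k} → EdgeDisjointPaths G a b k → EdgeConnected G k a b
paths⇒edgeConnected {G = G} (P , disjoint) X a≢b = injection⇒≤cutSize G X
  (λ i → proj₁ (crossed i))
  (λ i j eq → decidable-stable (i ≟ j) λ i≢j → disjoint i j i≢j
     (proj₁ (proj₂ (crossed i)) , subst (_∈ walkEdges (walk (P j))) (sym eq) (proj₁ (proj₂ (crossed j)))))
  (λ i → proj₂ (proj₂ (crossed i)))
  where crossed = λ i → crossing-step (walk (P i)) X a≢b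

count-replicate : ∀ {n} (X : Cut n) k a → count X (replicate k a) ≡ k * bit (X a)
count-replicate X zero    a = refl
count-replicate X (suc k) a = cong (bit (X a) +_) (count-replicate X k a)

-- Menger's theorem is the case of k equal sources and k equal sinks: only the sets containing `a`
-- but not `b` impose a condition, and it asks for k crossing edges.
edgeConnected⇒routable : ∀ {n} (G : Graph n) {a b k} → EdgeConnected G k a b →
                         Routable G (replicate k a) (replicate k b)
edgeConnected⇒routable G {a} {b} {k} conn X
  rewrite count-replicate X k a | count-replicate X k b with X a in Xa | X b in Xb
... | true  | true  = m≤m+n _ _
... | false | w     = subst (_≤ k * bit w + cutSize G X) (sym (*-zeroʳ k)) z≤n
... | true  | false = subst₂ _≤_ (sym (*-identityʳ k)) (cong (_+ cutSize G X) (sym (*-zeroʳ k)))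
                        (conn X λ eq → case trans (sym Xa) (trans eq Xb) of λ ())

AllPairs-lookup : ∀ {A : Set} {R : A → A → Set} → (∀ {x y} → R x y → R y x) → ∀ {xs} → AllPairs R xs →
                  ∀ i j → i ≢ j → R (lookup xs i) (lookup xs j)
AllPairs-lookup sy (r ∷ rs) zero    zero    i≢j = contradiction refl i≢j
AllPairs-lookup sy (r ∷ rs) zero    (suc j) i≢j = All.lookup r (∈-lookup j)
AllPairs-lookup sy (r ∷ rs) (suc i) zero    i≢j = sy (All.lookup r (∈-lookup i))
AllPairs-lookup sy (r ∷ rs) (suc i) (suc j) i≢j = AllPairs-lookup sy rs i j (i≢j ∘ cong suc)

linkage⇒paths : ∀ {n} {G : Graph n} {a b} k → Linkage G (replicate k a) (replicate k b) → EdgeDisjointPaths G a b k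
linkage⇒paths {n} {G} {a} {b} k K = subst (EdgeDisjointPaths G a b) walks-length (P , P-disjoint)
  where
  open Linkage K
  walks-length : length walks ≡ k
  walks-length = trans (sym (length-map proj₁ walks)) (trans (↭-length sources) (length-replicate k))
  constant : ∀ (f : AnyWalk {G = G} → Fin n) {c} → map f walks ↭ replicate k c → ∀ {W} → W ∈ walks → f W ≡ c
  constant f {c} p W∈ = All.lookup {P = _≡ c} (All.replicate⁺ k refl) (∈-resp-↭ p (∈-map⁺ f W∈))
  erased : ∀ (W : AnyWalk {G = G}) → proj₁ W ≡ a → proj₁ (proj₂ W) ≡ b →
    Σ[ q ∈ Path G a b ] (∀ {i} → i ∈ walkEdges (walk q) → i ∈ edgesOf W)
  erased (_ , _ , p) refl refl = erase-loops p
  route : ∀ i → Σ[ q ∈ Path G a b ] (∀ {j} → j ∈ walkEdges (walk q) → j ∈ edgesOf (lookup walks i))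
  route i = erased (lookup walks i) (constant proj₁ sources (∈-lookup i)) (constant (proj₁ ∘ proj₂) sinks (∈-lookup i))
  P : Fin (length walks) → Path G a b
  P i = proj₁ (route i)
  P-disjoint : ∀ i j → i ≢ j → Disjoint (walkEdges (walk (P i))) (walkEdges (walk (P j)))
  P-disjoint i j i≢j (∈i , ∈j) = AllPairs-lookup {R = DisjointWalks} (λ d {_} (x , y) → d (y , x)) disjoint i j i≢j
    (proj₂ (route i) ∈i , proj₂ (route j) ∈j)

menger : ∀ {n} {G : Graph n} {a b k} → EdgeConnected G k a b → ¬ ¬ EdgeDisjointPaths G a b k
menger {G = G} {a} {b} {k} conn ¬P = routable⇒linkage G (replicate k a) (replicate k b)
  (trans (length-replicate k) (sym (length-replicate k))) (edgeConnected⇒routable G conn) (¬P ∘ linkage⇒paths k)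

-- Minimal 2-edge-connectivity in terms of cuts

Separates : ∀ {n} → Cut n → Set
Separates X = ∃[ x ] ∃[ y ] X x ≢ X y

connected⇒crossed : ∀ {n} {G : Graph n} → Connected G → ∀ X → Separates X → 1 ≤ cutSize G X
connected⇒crossed {G = G} conn X (x , y , x≢y) =
  let i , _ , c = crossing-step (walk (conn x y)) X x≢y
  in injection⇒≤cutSize {k = 1} G X (λ _ → i) (λ where zero zero _ → refl) (λ _ → c)

crossed⇒connected : ∀ {n} {G : Graph n} → (∀ X → Separates X → 1 ≤ cutSize G X) → ¬ ¬ Connected G
crossed⇒connected {G = G} crossed = ¬¬-finite λ u → ¬¬-finite λ v → path u v
  where
  path : ∀ u v → ¬ ¬ Path G u v
  path u v k with u ≟ v
  ... | yes refl = k record { walk = stop ; simple = [] ∷ [] }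
  ... | no u≢v   = menger {k = 1} (λ X X≢ → crossed X (u , v , X≢)) λ (P , _) → k (P zero)

cutSize-∖ : ∀ {n} (G : Graph n) S X → cutSize G X ≤ cutSize (G ∖ S) X + ∣ S ∣
cutSize-∖ []      Vec.[]              X = z≤n
cutSize-∖ (e ∷ G) (outside Vec.∷ S)   X = subst (cutSize (e ∷ G) X ≤_) (sym (+-assoc (separation X e) _ _)) (+-monoʳ-≤ (separation X e) (cutSize-∖ G S X))
cutSize-∖ (e ∷ G) (inside  Vec.∷ S)   X = subst (cutSize (e ∷ G) X ≤_) (sym (+-suc _ _)) (+-mono-≤ (sep≤1 (X (end₁ e)) (X (end₂ e))) (cutSize-∖ G S X))

cutSize-∖-covered : ∀ {n} (G : Graph n) S X → (∀ i → Crosses X (lookup G i) → i ∈ˢ S) → cutSize (G ∖ S) X ≡ 0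
cutSize-∖-covered []      Vec.[]            X cov = refl
cutSize-∖-covered (e ∷ G) (inside  Vec.∷ S) X cov = cutSize-∖-covered G S X λ i c → drop-there (cov (suc i) c)
cutSize-∖-covered (e ∷ G) (outside Vec.∷ S) X cov = cong₂ _+_
  (sep-≡ (decidable-stable (_ Bool.≟ _) λ c → case cov zero c of λ ()))
  (cutSize-∖-covered G S X λ i c → drop-there (cov (suc i) c))

∖-∅ : ∀ {n} (G : Graph n) → G ∖ ∅ ≡ G
∖-∅ []      = refl
∖-∅ (e ∷ G) = cong (e ∷_) (∖-∅ G)

cutSize-∖⁅⁆ : ∀ {n} (G : Graph n) i X → cutSize G X ≡ separation X (lookup G i) + cutSize (G ∖ ⁅ i ⁆) X
cutSize-∖⁅⁆ (e ∷ G) zero    X = cong (λ H → separation X e + cutSize H X) (sym (∖-∅ G))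
cutSize-∖⁅⁆ (e ∷ G) (suc i) X = trans (cong (separation X e +_) (cutSize-∖⁅⁆ G i X))
  (x∙yz≈y∙xz (separation X e) (separation X (lookup G i)) _)

∈-∖ : ∀ {n} (G : Graph n) S {g} → g ∈ G ∖ S → ∃[ i ] (i ∉ˢ S × lookup G i ≡ g)
∈-∖ [] Vec.[] ()
∈-∖ (e ∷ G) (inside  Vec.∷ S) g∈ with ∈-∖ G S g∈
... | i , i∉ , eq = suc i , (i∉ ∘ drop-there) , eq
∈-∖ (e ∷ G) (outside Vec.∷ S) (here refl) = zero , (λ ()) , refl
∈-∖ (e ∷ G) (outside Vec.∷ S) (there g∈) with ∈-∖ G S g∈
... | i , i∉ , eq = suc i , (i∉ ∘ drop-there) , eq

crossing : ∀ {n} (G : Graph n) → Cut n → Subset (length G)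
crossing []      X = Vec.[]
crossing (e ∷ G) X = does (crosses? X e) Vec.∷ crossing G X

∣crossing∣ : ∀ {n} (G : Graph n) X → ∣ crossing G X ∣ ≡ cutSize G X
∣crossing∣ []      X = refl
∣crossing∣ (e ∷ G) X with X (end₁ e) | X (end₂ e)
... | true  | true  = ∣crossing∣ G X
... | true  | false = cong suc (∣crossing∣ G X)
... | false | true  = cong suc (∣crossing∣ G X)
... | false | false = ∣crossing∣ G X

∈-crossing : ∀ {n} (G : Graph n) X i → Crosses X (lookup G i) → i ∈ˢ crossing G X
∈-crossing (e ∷ G) X zero    c = subst (λ b → zero ∈ˢ (b Vec.∷ crossing G X)) (sym (dec-true (crosses? X e) c)) Vec.here
∈-crossing (e ∷ G) X (suc i) c = Vec.there (∈-crossing G X i c)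

-- Minimality means that each edge lies in a 2-edge cut. In `tight` the bound `≤ 2` is an equality
-- by `twoEC`, since a cut crossed by an edge is nontrivial.
record MinTwoEC {n} (G : Graph n) : Set where
  field
    twoEC : ∀ X → Separates X → 2 ≤ cutSize G X
    tight : ∀ i → ∃[ X ] (Crosses X (lookup G i) × cutSize G X ≤ 2)

uncut : ∀ {n} {G : Graph n} → ¬ Connected G → ¬ ¬ (∃[ X ] (Separates X × cutSize G X ≡ 0))
uncut {G = G} ¬conn k = crossed⇒connected (λ X s → n≢0⇒n>0 λ 0≡ → k (X , s , 0≡)) ¬conn

cutSize-0⇒¬connected : ∀ {n} {G : Graph n} {X} → Separates X → cutSize G X ≡ 0 → ¬ Connected G
cutSize-0⇒¬connected s 0≡ conn = contradiction (subst (1 ≤_) 0≡ (connected⇒crossed conn _ s)) λ ()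

removeCrossing : ∀ {n} (G : Graph n) X → Separates X → DisconnectedByRemoving G (cutSize G X)
removeCrossing G X s = crossing G X , ∣crossing∣ G X ,
  cutSize-0⇒¬connected s (cutSize-∖-covered G (crossing G X) X (∈-crossing G X))

fromMinimallyTwoEdgeConnected : ∀ {n} {G : Graph n} → MinimallyTwoEdgeConnected G → ¬ ¬ MinTwoEC G
fromMinimallyTwoEdgeConnected {G = G} ((_ , least) , min) k = ¬¬-finite tight λ t → k record { twoEC = twoEC ; tight = t }
  where
  twoEC : ∀ X → Separates X → 2 ≤ cutSize G X
  twoEC X s = least (cutSize G X) (removeCrossing G X s)
  tight : ∀ i → ¬ ¬ (∃[ X ] (Crosses X (lookup G i) × cutSize G X ≤ 2))
  tight i k with min i
  ... | l , ((S , ∣S∣≡l , ¬conn) , _) , s≤s l≤1 = uncut ¬conn λ (X , s , 0≡) →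
    let few : cutSize (G ∖ ⁅ i ⁆) X ≤ 1
        few = ≤-trans (cutSize-∖ (G ∖ ⁅ i ⁆) S X) (subst (_≤ 1) (sym (cong₂ _+_ 0≡ ∣S∣≡l)) l≤1)
    -- If the edge `i` did not cross `X`, this cut would have at most one edge in `G` as well.
    in k (X , (λ eq → <⇒≱ (s≤s few) (subst (2 ≤_) (trans (cutSize-∖⁅⁆ G i X) (cong (_+ cutSize (G ∖ ⁅ i ⁆) X) (sep-≡ eq))) (twoEC X s)))
            , ≤-trans (cutSize-∖ G ⁅ i ⁆ X) (subst (λ m → cutSize (G ∖ ⁅ i ⁆) X + m ≤ 2) (sym (∣⁅x⁆∣≡1 i)) (+-monoˡ-≤ 1 few)))

toMinimallyTwoEdgeConnected : ∀ {n} {G : Graph (suc (suc n))} → MinTwoEC G → MinimallyTwoEdgeConnected G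
toMinimallyTwoEdgeConnected {n} {G} M = (witness₂ , least₂) , λ i → 1 , (witness₁ i , least₁ i) , s≤s (s≤s z≤n)
  where
  open MinTwoEC M
  separates : ∀ {X i} → Crosses X (lookup G i) → Separates X
  separates c = _ , _ , c
  tight≡ : ∀ i → let X , _ = tight i in cutSize G X ≡ 2
  tight≡ i = let X , c , ≤2 = tight i in ≤-antisym ≤2 (twoEC X (separates c))
  -- That the value 2 is attained has to be shown by a 2-edge cut, and `tight` gives one for every
  -- edge. An edge exists because, with two vertices, the cut around `zero` is nontrivial.
  some : Fin (length G)
  some = position G (twoEC ⁅ zero ⁆ᶜ (zero , suc zero , λ ()))
    where
    position : ∀ (G : Graph (suc (suc n))) {X} → 2 ≤ cutSize G X → Fin (length G)
    position (_ ∷ _) _ = zero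
  witness₂ : DisconnectedByRemoving G 2
  witness₂ = let X , c , _ = tight some in subst (DisconnectedByRemoving G) (tight≡ some) (removeCrossing G X (separates c))
  least₂ : ∀ j → DisconnectedByRemoving G j → 2 ≤ j
  least₂ j (S , refl , ¬conn) = decidable-stable (2 ≤? j) λ ¬2≤ → uncut ¬conn λ (X , s , 0≡) →
    ¬2≤ (≤-trans (twoEC X s) (subst (λ m → cutSize G X ≤ m + ∣ S ∣) 0≡ (cutSize-∖ G S X)))
  witness₁ : ∀ i → DisconnectedByRemoving (G ∖ ⁅ i ⁆) 1
  witness₁ i = let X , c , _ = tight i in subst (DisconnectedByRemoving (G ∖ ⁅ i ⁆))
    (suc-injective (trans (cong (_+ cutSize (G ∖ ⁅ i ⁆) X) (sym (sep-≢ c))) (trans (sym (cutSize-∖⁅⁆ G i X)) (tight≡ i))))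
    (removeCrossing (G ∖ ⁅ i ⁆) X (separates c))
  least₁ : ∀ i j → DisconnectedByRemoving (G ∖ ⁅ i ⁆) j → 1 ≤ j
  least₁ i j (S , refl , ¬conn) = decidable-stable (1 ≤? j) λ ¬1≤ → uncut ¬conn λ (X , s , 0≡) →
    ¬1≤ (+-cancelʳ-≤ 1 1 ∣ S ∣ (≤-trans (twoEC X s) (≤-trans (cutSize-∖ G ⁅ i ⁆ X)
      (subst (λ m → cutSize (G ∖ ⁅ i ⁆) X + m ≤ ∣ S ∣ + 1) (sym (∣⁅x⁆∣≡1 i)) (+-monoˡ-≤ 1 (subst (λ m → cutSize (G ∖ ⁅ i ⁆) X ≤ m + ∣ S ∣) 0≡ (cutSize-∖ (G ∖ ⁅ i ⁆) S X)))))))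

-- Sums over pairs of vertices

∑-mono : ∀ {n} {f g : Fin n → ℕ} → (∀ i → f i ≤ g i) → ∑ f ≤ ∑ g
∑-mono {zero}  f≤g = z≤n
∑-mono {suc n} f≤g = +-mono-≤ (f≤g zero) (∑-mono (f≤g ∘ suc))

∑-mono-< : ∀ {n} {f g : Fin n → ℕ} → (∀ i → f i ≤ g i) → ∀ i → f i < g i → ∑ f < ∑ g
∑-mono-< {suc n} f≤g zero    f<g = +-mono-<-≤ f<g (∑-mono (f≤g ∘ suc))
∑-mono-< {suc n} f≤g (suc i) f<g = +-mono-≤-< (f≤g zero) (∑-mono-< (f≤g ∘ suc) i f<g)

δ : ∀ {n} → Fin n → ℕ → Fin n → ℕ
δ u c b = if does (b ≟ u) then c else 0

∑-δ : ∀ {n} (u : Fin n) c → ∑ (δ u c) ≡ c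
∑-δ {suc n} zero    c = trans (cong (c +_) (sum-replicate-zero n)) (+-identityʳ c)
∑-δ {suc n} (suc u) c = ∑-δ u c

rest : ∀ {n} → Fin n → Fin n → (Fin n → ℕ) → Fin n → ℕ
rest u v f b = if does (b ≟ u) then 0 else if does (b ≟ v) then 0 else f b

∑-rest : ∀ {n} {u v : Fin n} → u ≢ v → ∀ f → ∑ f ≡ ∑ (rest u v f) + (f u + f v)
∑-rest {u = u} {v} u≢v f = begin
  ∑ f                                                        ≡⟨ sum-cong-≗ split ⟩
  ∑ (λ b → rest u v f b + (δ u (f u) b + δ v (f v) b))       ≡⟨ ∑-distrib-+ (rest u v f) _ ⟩
  ∑ (rest u v f) + ∑ (λ b → δ u (f u) b + δ v (f v) b)       ≡⟨ cong (∑ (rest u v f) +_) (∑-distrib-+ (δ u (f u)) _) ⟩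
  ∑ (rest u v f) + (∑ (δ u (f u)) + ∑ (δ v (f v)))           ≡⟨ cong (∑ (rest u v f) +_) (cong₂ _+_ (∑-δ u (f u)) (∑-δ v (f v))) ⟩
  ∑ (rest u v f) + (f u + f v)                               ∎
  where
  open ≡-Reasoning
  split : ∀ b → f b ≡ rest u v f b + (δ u (f u) b + δ v (f v) b)
  split b with b ≟ u | b ≟ v
  ... | yes refl | yes refl = contradiction refl u≢v
  ... | yes refl | no _     = sym (+-identityʳ _)
  ... | no _     | yes refl = refl
  ... | no _     | no _     = sym (+-identityʳ _)

module _ {n} {u v : Fin n} (u≢v : u ≢ v) {f g : Fin n → ℕ}
         (off : ∀ b → b ≢ u → b ≢ v → f b ≤ g b) where

  private
    rest-mono : ∀ b → rest u v f b ≤ rest u v g b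
    rest-mono b with b ≟ u | b ≟ v
    ... | yes _  | _      = z≤n
    ... | no _   | yes _  = z≤n
    ... | no b≢u | no b≢v = off b b≢u b≢v

  ∑-merge : f u + f v ≤ g u + g v → ∑ f ≤ ∑ g
  ∑-merge on = subst₂ _≤_ (sym (∑-rest u≢v f)) (sym (∑-rest u≢v g)) (+-mono-≤ (∑-mono rest-mono) on)

  ∑-merge-<-on : f u + f v < g u + g v → ∑ f < ∑ g
  ∑-merge-<-on on = subst₂ _<_ (sym (∑-rest u≢v f)) (sym (∑-rest u≢v g)) (+-mono-≤-< (∑-mono rest-mono) on)

  ∑-merge-<-off : f u + f v ≤ g u + g v → ∀ b → b ≢ u → b ≢ v → f b < g b → ∑ f < ∑ g
  ∑-merge-<-off on b b≢u b≢v f<g = subst₂ _<_ (sym (∑-rest u≢v f)) (sym (∑-rest u≢v g))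
    (+-mono-<-≤ (∑-mono-< rest-mono b rest-<) on)
    where
    rest-< : rest u v f b < rest u v g b
    rest-< rewrite dec-false (b ≟ u) b≢u | dec-false (b ≟ v) b≢v = f<g

total : ∀ {n} → (Fin n → Fin n → ℕ) → ℕ
total {n} L = sum (map (uncurry L) (vertexPairs n))

-- Diagonal entries of `L` are unconstrained, since λ is defined for distinct vertices only, and
-- must not enter the sums.
offDiagonal : ∀ {n} → (Fin n → Fin n → ℕ) → Fin n → Fin n → ℕ
offDiagonal L a b = if does (a ≟ b) then 0 else L a b

Symmetric : ∀ {n} → (Fin n → Fin n → ℕ) → Set
Symmetric L = ∀ a b → a ≢ b → L a b ≡ L b a

sum-filter : ∀ {A : Set} {P : A → Set} (P? : ∀ x → Dec (P x)) (f : A → ℕ) xs →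
  sum (map f (filter P? xs)) ≡ sum (map (λ x → if does (P? x) then f x else 0) xs)
sum-filter P? f []       = refl
sum-filter P? f (x ∷ xs) with does (P? x)
... | true  = cong (f x +_) (sum-filter P? f xs)
... | false = sum-filter P? f xs

sum-cartesianProduct : ∀ {A B : Set} (f : A × B → ℕ) xs ys →
  sum (map f (cartesianProduct xs ys)) ≡ sum (map (λ x → sum (map (λ y → f (x , y)) ys)) xs)
sum-cartesianProduct f []       ys = refl
sum-cartesianProduct f (x ∷ xs) ys = begin
  sum (map f (map (x ,_) ys ++ cartesianProduct xs ys))               ≡⟨ cong sum (map-++ f (map (x ,_) ys) _) ⟩
  sum (map f (map (x ,_) ys) ++ map f (cartesianProduct xs ys))       ≡⟨ sum-++ (map f (map (x ,_) ys)) _ ⟩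
  sum (map f (map (x ,_) ys)) + sum (map f (cartesianProduct xs ys))  ≡⟨ cong₂ _+_ (cong sum (sym (map-∘ ys))) (sum-cartesianProduct f xs ys) ⟩
  _ ∎
  where open ≡-Reasoning

sum-allFin : ∀ {n} (f : Fin n → ℕ) → sum (map f (allFin n)) ≡ ∑ f
sum-allFin f = trans (cong sum (map-tabulate id f)) (sum-tabulate f)
  where
  sum-tabulate : ∀ {n} (f : Fin n → ℕ) → sum (tabulate f) ≡ ∑ f
  sum-tabulate {zero}  f = refl
  sum-tabulate {suc n} f = cong (f zero +_) (sum-tabulate (f ∘ suc))

-- The full square makes whole rows comparable. Among the pairs a < b alone, the entries for {a,u}
-- and {a,v} may lie in different rows, although only their sum is controlled.
double-total : ∀ {n} {L : Fin n → Fin n → ℕ} → Symmetric L → ∑ (λ a → ∑ (offDiagonal L a)) ≡ total L + total L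
double-total {n} {L} L-sym = begin
  ∑ (λ a → ∑ (offDiagonal L a))                        ≡⟨ sum-cong-≗ (λ a → sum-cong-≗ (λ b → split a b)) ⟩
  ∑ (λ a → ∑ (λ b → up a b + up b a))                  ≡⟨ sum-cong-≗ (λ a → ∑-distrib-+ (up a) _) ⟩
  ∑ (λ a → ∑ (up a) + ∑ (λ b → up b a))                ≡⟨ ∑-distrib-+ (λ a → ∑ (up a)) _ ⟩
  ∑ (λ a → ∑ (up a)) + ∑ (λ a → ∑ (λ b → up b a))      ≡⟨ cong (∑ (λ a → ∑ (up a)) +_) (∑-comm (λ a b → up b a)) ⟩
  ∑ (λ a → ∑ (up a)) + ∑ (λ a → ∑ (up a))              ≡⟨ cong₂ _+_ (sym total-up) (sym total-up) ⟩
  total L + total L                                    ∎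
  where
  open ≡-Reasoning
  up : Fin n → Fin n → ℕ
  up a b = if does (a <? b) then L a b else 0
  split : ∀ a b → offDiagonal L a b ≡ up a b + up b a
  split a b with Fin.<-cmp a b
  ... | tri< a<b a≢b b≮a rewrite dec-false (a ≟ b) a≢b | dec-true (a <? b) a<b | dec-false (b <? a) b≮a = sym (+-identityʳ _)
  ... | tri≈ a≮b refl b≮a rewrite dec-true (a ≟ b) refl | dec-false (a <? b) a≮b = refl
  ... | tri> a≮b a≢b b<a rewrite dec-false (a ≟ b) a≢b | dec-false (a <? b) a≮b | dec-true (b <? a) b<a = L-sym a b a≢b
  total-up : total L ≡ ∑ (λ a → ∑ (up a))
  total-up = begin
    total L
      ≡⟨ sum-filter (uncurry _<?_) (uncurry L) (cartesianProduct (allFin n) (allFin n)) ⟩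
    sum (map (λ (a , b) → up a b) (cartesianProduct (allFin n) (allFin n)))
      ≡⟨ sum-cartesianProduct (λ (a , b) → up a b) (allFin n) (allFin n) ⟩
    sum (map (λ a → sum (map (up a) (allFin n))) (allFin n))
      ≡⟨ sum-allFin (λ a → sum (map (up a) (allFin n))) ⟩
    ∑ (λ a → sum (map (up a) (allFin n)))
      ≡⟨ sum-cong-≗ (λ a → sum-allFin (up a)) ⟩
    ∑ (λ a → ∑ (up a)) ∎

+-cancel-double-≤ : ∀ {m n} → m + m ≤ n + n → m ≤ n
+-cancel-double-≤ mm≤nn = ≮⇒≥ λ n<m → <⇒≱ (+-mono-< n<m n<m) mm≤nn

+-cancel-double-< : ∀ {m n} → m + m < n + n → m < n
+-cancel-double-< mm<nn = ≰⇒> λ n≤m → <⇒≱ mm<nn (+-mono-≤ n≤m n≤m)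

-- The values at u and v enter only through their sums, because the moves below
-- may exchange λ(a,u) and λ(a,v).
module Compare {n} {L L′ : Fin n → Fin n → ℕ} (L-sym : Symmetric L) (L′-sym : Symmetric L′)
  {u v : Fin n} (u≢v : u ≢ v)
  (away : ∀ a b → a ≢ b → a ≢ u → a ≢ v → b ≢ u → b ≢ v → L a b ≤ L′ a b)
  (pair : ∀ a → a ≢ u → a ≢ v → L a u + L a v ≤ L′ a u + L′ a v)
  (joint : L u v ≤ L′ u v) where

  private
    M M′ : Fin n → Fin n → ℕ
    M  = offDiagonal L
    M′ = offDiagonal L′

    off≡ : ∀ {L : Fin n → Fin n → ℕ} {a b} → a ≢ b → offDiagonal L a b ≡ L a b
    off≡ {a = a} {b} a≢b rewrite dec-false (a ≟ b) a≢b = refl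

    off-diag : ∀ {L : Fin n → Fin n → ℕ} a → offDiagonal L a a ≡ 0
    off-diag a rewrite dec-true (a ≟ a) refl = refl

    off-sym : ∀ {L : Fin n → Fin n → ℕ} → Symmetric L → ∀ a b → offDiagonal L a b ≡ offDiagonal L b a
    off-sym {L} sy a b with a ≟ b
    ... | yes refl = sym (off-diag {L} a)
    ... | no a≢b   = trans (sy a b a≢b) (sym (off≡ {L} (a≢b ∘ sym)))

    M-away : ∀ a → a ≢ u → a ≢ v → ∀ b → b ≢ u → b ≢ v → M a b ≤ M′ a b
    M-away a a≢u a≢v b b≢u b≢v with a ≟ b
    ... | yes _  = z≤n
    ... | no a≢b = away a b a≢b a≢u a≢v b≢u b≢v

    M-pair : ∀ a → a ≢ u → a ≢ v → M a u + M a v ≤ M′ a u + M′ a v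
    M-pair a a≢u a≢v = subst₂ _≤_ (sym (cong₂ _+_ (off≡ {L} a≢u) (off≡ {L} a≢v))) (sym (cong₂ _+_ (off≡ {L′} a≢u) (off≡ {L′} a≢v))) (pair a a≢u a≢v)

    joint′ : L v u ≤ L′ v u
    joint′ = subst₂ _≤_ (L-sym u v u≢v) (L′-sym u v u≢v) joint

    row : Fin n → ℕ
    row a = ∑ (M a)
    row′ : Fin n → ℕ
    row′ a = ∑ (M′ a)

    row-≤ : ∀ a → a ≢ u → a ≢ v → row a ≤ row′ a
    row-≤ a a≢u a≢v = ∑-merge u≢v (M-away a a≢u a≢v) (M-pair a a≢u a≢v)

    -- By symmetry the columns of `u` and `v` are their rows, so `M-pair` also compares the sum of
    -- these two rows outside the two-by-two corner; the corner itself is λ(u,v) counted twice.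
    rows-uv : row u + row v ≤ row′ u + row′ v
    rows-uv = subst₂ _≤_ (∑-distrib-+ (M u) (M v)) (∑-distrib-+ (M′ u) (M′ v)) (∑-merge u≢v
      (λ b b≢u b≢v → subst₂ _≤_ (cong₂ _+_ (off-sym L-sym b u) (off-sym L-sym b v)) (cong₂ _+_ (off-sym L′-sym b u) (off-sym L′-sym b v)) (M-pair b b≢u b≢v))
      (subst₂ _≤_ (corner L) (corner L′) (+-mono-≤ joint′ joint)))
      where
      corner : ∀ L → L v u + L u v ≡ (offDiagonal L u u + offDiagonal L v u) + (offDiagonal L u v + offDiagonal L v v)
      corner L = sym (cong₂ _+_ (cong₂ _+_ (off-diag {L} u) (off≡ {L} (u≢v ∘ sym)))
                                (trans (cong₂ _+_ (off≡ {L} u≢v) (off-diag {L} v)) (+-identityʳ _)))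

    from-< : ∀ a → a ≢ u → a ≢ v → row a < row′ a → total L < total L′
    from-< a a≢u a≢v r< = +-cancel-double-< (subst₂ _<_ (double-total L-sym) (double-total L′-sym)
      (∑-merge-<-off u≢v row-≤ rows-uv a a≢u a≢v r<))

  total-≤ : total L ≤ total L′
  total-≤ = +-cancel-double-≤ (subst₂ _≤_ (double-total L-sym) (double-total L′-sym) (∑-merge u≢v row-≤ rows-uv))

  total-<-away : ∀ a b → a ≢ b → a ≢ u → a ≢ v → b ≢ u → b ≢ v → L a b < L′ a b → total L < total L′
  total-<-away a b a≢b a≢u a≢v b≢u b≢v l< = from-< a a≢u a≢v
    (∑-merge-<-off u≢v (M-away a a≢u a≢v) (M-pair a a≢u a≢v) b b≢u b≢v
      (subst₂ _<_ (sym (off≡ {L} a≢b)) (sym (off≡ {L′} a≢b)) l<))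

  total-<-pair : ∀ a → a ≢ u → a ≢ v → L a u + L a v < L′ a u + L′ a v → total L < total L′
  total-<-pair a a≢u a≢v l< = from-< a a≢u a≢v
    (∑-merge-<-on u≢v (M-away a a≢u a≢v)
      (subst₂ _<_ (sym (cong₂ _+_ (off≡ {L} a≢u) (off≡ {L} a≢v))) (sym (cong₂ _+_ (off≡ {L′} a≢u) (off≡ {L′} a≢v))) l<))

-- Optimality in terms of cuts and totals

/-cancelʳ-≤ : ∀ d .{{_ : NonZero d}} {s t} → (ℤ.+ s) / d ℚ.≤ (ℤ.+ t) / d → s ≤ t
/-cancelʳ-≤ (suc d) {s} {t} s/d≤t/d = ℤ.drop‿+≤+ (ℤ.*-cancelʳ-≤-pos (ℤ.+ s) (ℤ.+ t) (ℤ.+ suc d) (ℚᵘ.drop-*≤* unnormalised))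
  where
  -- `_/_` reduces fractions, so the common denominator reappears only among the unnormalised
  -- rationals.
  unnormalised : ℚᵘ.mkℚᵘ (ℤ.+ s) d ℚᵘ.≤ ℚᵘ.mkℚᵘ (ℤ.+ t) d
  unnormalised = ℚᵘ.≤-respˡ-≃ (ℚ.toℚᵘ-fromℚᵘ (ℚᵘ.mkℚᵘ (ℤ.+ s) d))
    (ℚᵘ.≤-respʳ-≃ (ℚ.toℚᵘ-fromℚᵘ (ℚᵘ.mkℚᵘ (ℤ.+ t) d)) (ℚ.toℚᵘ-mono-≤ s/d≤t/d))

record LocalCuts {n} (G : Graph n) (L : Fin n → Fin n → ℕ) : Set where
  field
    connected : ∀ a b → a ≢ b → EdgeConnected G (L a b) a b
    greatest  : ∀ a b → a ≢ b → ∀ {k} → EdgeConnected G k a b → k ≤ L a b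

  symmetric : Symmetric L
  symmetric a b a≢b = ≤-antisym (greatest b a (a≢b ∘ sym) (λ X X≢ → connected a b a≢b X (X≢ ∘ sym)))
                                (greatest a b a≢b (λ X X≢ → connected b a (a≢b ∘ sym) X (X≢ ∘ sym)))

¬¬-greatest : ∀ {Q : ℕ → Set} B → Q 0 → (∀ k → Q k → k ≤ B) → ¬ ¬ (∃[ k ] IsGreatest Q k)
¬¬-greatest zero    q0 bound k = k (0 , q0 , bound)
¬¬-greatest {Q} (suc B) q0 bound k = ¬¬-excluded-middle {A = Q (suc B)} λ where
    (yes q) → k (suc B , q , bound)
    (no ¬q) → ¬¬-greatest B q0 (λ j qj → s≤s⁻¹ (≤∧≢⇒< (bound j qj) λ where refl → ¬q qj)) k

-- A modified graph can be compared with `G` only once its local connectivities are given. They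
-- exist because λ(a,b) is bounded by the cut around `a`.
localCuts-exist : ∀ {n} (G : Graph n) → ¬ ¬ (∃[ L ] LocalCuts G L)
localCuts-exist {n} G k = ¬¬-finite (λ a → ¬¬-finite (value a)) λ values → k
  ( (λ a b → proj₁ (values a b))
  , record { connected = λ a b a≢b → proj₁ (proj₂ (values a b) a≢b)
           ; greatest  = λ a b a≢b → proj₂ (proj₂ (values a b) a≢b) _ })
  where
  value : ∀ a b → ¬ ¬ (∃[ k ] (a ≢ b → IsGreatest (λ k → EdgeConnected G k a b) k))
  value a b ¬v with a ≟ b
  ... | yes a≡b = ¬v (0 , λ a≢b → contradiction a≡b a≢b)
  ... | no a≢b  = ¬¬-greatest (cutSize G ⁅ a ⁆ᶜ) (λ _ _ → z≤n)
    (λ _ conn → conn ⁅ a ⁆ᶜ (⁅⁆-separates a≢b))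
    λ (k , g) → ¬v (k , λ _ → g)

fromLocal : ∀ {n} {G : Graph n} {L} → (∀ a b → a ≢ b → LocalEdgeConnectivity G a b (L a b)) → LocalCuts G L
fromLocal local = record
  { connected = λ a b a≢b → paths⇒edgeConnected (proj₁ (local a b a≢b))
  ; greatest  = λ a b a≢b {k} conn → decidable-stable (k ≤? _) λ k≰ → menger conn (k≰ ∘ proj₂ (local a b a≢b) k)
  }

toLocal : ∀ {n} {G : Graph n} {L} → LocalCuts G L → ¬ ¬ (∀ a b → a ≢ b → LocalEdgeConnectivity G a b (L a b))
toLocal {G = G} {L} cuts = ¬¬-finite λ a → ¬¬-finite λ b → local a b
  where
  open LocalCuts cuts
  local : ∀ a b → ¬ ¬ (a ≢ b → LocalEdgeConnectivity G a b (L a b))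
  local a b k = k λ a≢b → contradiction (λ P → k λ _ → P , λ j Pj → greatest a b a≢b (paths⇒edgeConnected Pj)) (menger (connected a b a≢b))

-- All competitors have the same order, so the averages share a denominator and `total` can replace
-- them.
record Optimal {n} (G : Graph n) (L : Fin n → Fin n → ℕ) : Set where
  field
    minTwoEC  : MinTwoEC G
    localCuts : LocalCuts G L
    best      : ∀ (H : Graph n) → MinTwoEC H → ∀ L′ → LocalCuts H L′ → total L′ ≤ total L
  open MinTwoEC minTwoEC public
  open LocalCuts localCuts public

separated-≤2 : ∀ {n} {G : Graph n} {L} → Optimal G L → ∀ {X a b} → cutSize G X ≤ 2 → X a ≢ X b → L a b ≤ 2
separated-≤2 opt {X} X≤2 X≢ = ≤-trans (Optimal.connected opt _ _ (λ eq → X≢ (cong X eq)) X X≢) X≤2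

fromEdgeOptimal : ∀ {n} {G : Graph (suc (suc n))} → EdgeOptimal G → ¬ ¬ (∃[ L ] Optimal G L)
fromEdgeOptimal {n} {G} (min , q , average , q-best) k = fromMinimallyTwoEdgeConnected min λ min′ → k (local , record
  { minTwoEC  = min′
  ; localCuts = fromLocal isLocal
  ; best      = λ H H-min L′ cuts → decidable-stable (_ ≤? _) λ ≰ → toLocal cuts λ isLocal′ → ≰
      (/-cancelʳ-≤ (suc (suc n) C 2) (subst (_ ℚ.≤_) isAverage (q-best H _ (toMinimallyTwoEdgeConnected H-min)
        record { local = L′ ; isLocal = isLocal′ ; isAverage = refl })))
  })
  where open AverageEdgeConnectivity average

-- Contracting an edge and reinserting a vertex of degree 2

cutSize-cong : ∀ {n} (G : Graph n) {X Y : Cut n} → (∀ x → X x ≡ Y x) → cutSize G X ≡ cutSize G Y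
cutSize-cong []      X≗Y = refl
cutSize-cong (e ∷ G) X≗Y = cong₂ _+_ (cong₂ sep (X≗Y _) (X≗Y _)) (cutSize-cong G X≗Y)

cutSize-constant : ∀ {n} (G : Graph n) {X : Cut n} → (∀ x y → X x ≡ X y) → cutSize G X ≡ 0
cutSize-constant []      const = refl
cutSize-constant (e ∷ G) const = cong₂ _+_ (sep-≡ (const _ _)) (cutSize-constant G const)

-- The vertex set stays the same: for `u ≢ v`, the vertex `v` is left isolated, ready to be
-- reinserted. Edges that would become loops are dropped, among them all those parallel to uv.
module Contraction {n} (u v : Fin n) where

  merge : Fin n → Fin n
  merge x = if does (x ≟ v) then u else x

  merge-≢ : ∀ {x} → x ≢ v → merge x ≡ x
  merge-≢ {x} x≢v rewrite dec-false (x ≟ v) x≢v = refl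

  merge-v : merge v ≡ u
  merge-v rewrite dec-true (v ≟ v) refl = refl

  merge-u : merge u ≡ u
  merge-u with u ≟ v
  ... | yes _ = refl
  ... | no _  = refl

  merge-≢v : u ≢ v → ∀ x → merge x ≢ v
  merge-≢v u≢v x with x ≟ v
  ... | yes _  = u≢v
  ... | no x≢v = x≢v

  ∘merge : ∀ {X : Cut n} → X u ≡ X v → ∀ x → X (merge x) ≡ X x
  ∘merge Xu≡Xv x with x ≟ v
  ... | yes refl = Xu≡Xv
  ... | no _     = refl

  contract : Graph n → Graph n
  contract []      = []
  contract (e ∷ G) with merge (end₁ e) ≟ merge (end₂ e)
  ... | yes _ = contract G
  ... | no ≢  = record { end₁ = merge (end₁ e) ; end₂ = merge (end₂ e) ; noLoop = ≢ } ∷ contract G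

  cutSize-contract : ∀ G X → cutSize (contract G) X ≡ cutSize G (X ∘ merge)
  cutSize-contract []      X = refl
  cutSize-contract (e ∷ G) X with merge (end₁ e) ≟ merge (end₂ e)
  ... | yes eq = cong₂ _+_ (sym (sep-≡ (cong X eq))) (cutSize-contract G X)
  ... | no _   = cong (sep (X (merge (end₁ e))) (X (merge (end₂ e))) +_) (cutSize-contract G X)

  origin : ∀ G (i : Fin (length (contract G))) → ∃[ j ]
    (end₁ (lookup (contract G) i) ≡ merge (end₁ (lookup G j)) × end₂ (lookup (contract G) i) ≡ merge (end₂ (lookup G j)))
  origin (e ∷ G) i with merge (end₁ e) ≟ merge (end₂ e)
  origin (e ∷ G) i       | yes _ = let j , eqs = origin G i in suc j , eqs
  origin (e ∷ G) zero    | no _  = zero , refl , refl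
  origin (e ∷ G) (suc i) | no _  = let j , eqs = origin G i in suc j , eqs

  image : ∀ G j → merge (end₁ (lookup G j)) ≢ merge (end₂ (lookup G j)) → ∃[ i ]
    (end₁ (lookup (contract G) i) ≡ merge (end₁ (lookup G j)) × end₂ (lookup (contract G) i) ≡ merge (end₂ (lookup G j)))
  image (e ∷ G) j ≢ with merge (end₁ e) ≟ merge (end₂ e)
  image (e ∷ G) zero    ≢ | yes eq = contradiction eq ≢
  image (e ∷ G) zero    ≢ | no _   = zero , refl , refl
  image (e ∷ G) (suc j) ≢ | yes _  = image G j ≢
  image (e ∷ G) (suc j) ≢ | no _   = let i , eqs = image G j ≢ in suc i , eqs

≢-≢⇒≡ : ∀ {x y z : Bool} → x ≢ y → y ≢ z → x ≡ z
≢-≢⇒≡ {true}  {true}          x≢y y≢z = contradiction refl x≢y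
≢-≢⇒≡ {true}  {false} {true}  x≢y y≢z = refl
≢-≢⇒≡ {true}  {false} {false} x≢y y≢z = contradiction refl y≢z
≢-≢⇒≡ {false} {false}         x≢y y≢z = contradiction refl x≢y
≢-≢⇒≡ {false} {true}  {false} x≢y y≢z = refl
≢-≢⇒≡ {false} {true}  {true}  x≢y y≢z = contradiction refl y≢z

-- v is merged into u, and reinserted as a vertex of degree 2 with neighbours p
-- and q; G₁ is G, possibly without an edge whose role the path p–v–q takes over.
module Move {n} {G : Graph n} {L} (opt : Optimal G L) {u v : Fin n} (u≢v : u ≢ v)
  (X₀ : Cut n) (X₀-uv : X₀ u ≢ X₀ v) (X₀-tight : cutSize G X₀ ≤ 2)
  {p q : Fin n} (p≢v : p ≢ v) (q≢v : q ≢ v) (G₁ : Graph n)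
  (rerouted : ∀ Y → Y u ≡ Y v → cutSize G Y ≤ sep (Y p) (Y q) + cutSize G₁ Y)
  (still-tight : ∀ i → Contraction.merge u v (end₁ (lookup G₁ i)) ≢ Contraction.merge u v (end₂ (lookup G₁ i)) →
     ∃[ Y ] (Y u ≡ Y v × Crosses Y (lookup G₁ i) × sep (Y p) (Y q) + cutSize G₁ Y ≤ 2))
  where

  open Contraction u v
  open Optimal opt

  H : Graph n
  H = record { noLoop = p≢v } ∷ record { noLoop = q≢v } ∷ contract G₁

  cutSize-H : ∀ X → cutSize H X ≡ sep (X p) (X v) + (sep (X q) (X v) + cutSize G₁ (X ∘ merge))
  cutSize-H X = cong (λ m → sep (X p) (X v) + (sep (X q) (X v) + m)) (cutSize-contract G₁ X)

  cutSize-H-≥₁ : ∀ X → sep (X p) (X q) + cutSize G₁ (X ∘ merge) ≤ cutSize H X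
  cutSize-H-≥₁ X = begin
    sep (X p) (X q) + d                       ≤⟨ +-monoˡ-≤ d (sep-triangle (X p) (X v) (X q)) ⟩
    sep (X p) (X v) + sep (X q) (X v) + d     ≡⟨ +-assoc (sep (X p) (X v)) _ _ ⟩
    sep (X p) (X v) + (sep (X q) (X v) + d)   ≡⟨ sym (cutSize-H X) ⟩
    cutSize H X                               ∎
    where
    open ≤-Reasoning
    d = cutSize G₁ (X ∘ merge)

  -- A cut pays for the path p-v-q at least as much as for an edge pq, and by `rerouted` such an
  -- edge makes `G₁` as hard to cut as `G`. This is why the move destroys no connectivity between
  -- merged vertices.
  cutSize-H-≥ : ∀ X → cutSize G (X ∘ merge) ≤ cutSize H X
  cutSize-H-≥ X = ≤-trans (rerouted (X ∘ merge) (cong X (trans merge-u (sym merge-v))))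
    (subst₂ (λ x y → sep x y + cutSize G₁ (X ∘ merge) ≤ cutSize H X)
      (cong X (sym (merge-≢ p≢v))) (cong X (sym (merge-≢ q≢v))) (cutSize-H-≥₁ X))

  -- Composing with `merge` forgets on which side `v` lies, and would trivialise a cut that only
  -- isolates `v`. A second vertex `p` on the side of `v` prevents this.
  separates-merge : ∀ {X p} → p ≢ v → X p ≡ X v → Separates X → Separates (X ∘ merge)
  separates-merge {X} {p} p≢v Xp≡Xv (x , y , x≢y) with X u Bool.≟ X v
  ... | yes Xu≡Xv = x , y , λ eq → x≢y (trans (sym (∘merge {X} Xu≡Xv x)) (trans eq (∘merge {X} Xu≡Xv y)))
  ... | no Xu≢Xv  = u , p , λ eq → Xu≢Xv (trans (cong X (sym merge-u)) (trans eq (trans (cong X (merge-≢ p≢v)) Xp≡Xv)))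

  twoEC-H : ∀ X → Separates X → 2 ≤ cutSize H X
  twoEC-H X s with X p Bool.≟ X v | X q Bool.≟ X v
  ... | yes p≡v | _       = ≤-trans (twoEC (X ∘ merge) (separates-merge {X} p≢v p≡v s)) (cutSize-H-≥ X)
  ... | no _    | yes q≡v = ≤-trans (twoEC (X ∘ merge) (separates-merge {X} q≢v q≡v s)) (cutSize-H-≥ X)
  ... | no p≢v  | no q≢v  = subst (2 ≤_) (sym (trans (cutSize-H X) (cong₂ (λ s t → s + (t + cutSize G₁ (X ∘ merge))) (sep-≢ p≢v) (sep-≢ q≢v))))
                              (s≤s (s≤s z≤n))

  ⁅v⁆-separates : ∀ {x} → x ≢ v → ⁅ v ⁆ᶜ x ≢ ⁅ v ⁆ᶜ v
  ⁅v⁆-separates x≢v = ⁅⁆-separates (x≢v ∘ sym) ∘ sym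

  ⁅v⁆-tight : cutSize H ⁅ v ⁆ᶜ ≤ 2
  ⁅v⁆-tight = begin
    cutSize H X                                                          ≡⟨ cutSize-H X ⟩
    sep (X p) (X v) + (sep (X q) (X v) + cutSize G₁ (X ∘ merge))         ≤⟨ +-mono-≤ (sep≤1 (X p) (X v)) (+-mono-≤ (sep≤1 (X q) (X v)) (≤-reflexive (cutSize-constant G₁ constant))) ⟩
    2                                                                    ∎
    where
    open ≤-Reasoning
    X = ⁅ v ⁆ᶜ
    constant : ∀ x y → X (merge x) ≡ X (merge y)
    constant x y = trans (dec-false (merge x ≟ v) (merge-≢v u≢v x)) (sym (dec-false (merge y ≟ v) (merge-≢v u≢v y)))

  module _ (Y : Cut n) (Yu≡Yv : Y u ≡ Y v) where

    private
      extension : Cut n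
      extension x = if does (x ≟ v) then Y p else Y x

      extension-v : extension v ≡ Y p
      extension-v rewrite dec-true (v ≟ v) refl = refl

      extension-≢ : ∀ {x} → x ≢ v → extension x ≡ Y x
      extension-≢ {x} x≢v rewrite dec-false (x ≟ v) x≢v = refl

      extension-merge : ∀ x → extension (merge x) ≡ Y x
      extension-merge x = trans (extension-≢ (merge-≢v u≢v x)) (∘merge {Y} Yu≡Yv x)

    -- The side of the new vertex v is chosen to agree with p.
    extend : ∃[ X ] ((∀ x → X (merge x) ≡ Y x) × cutSize H X ≡ sep (Y p) (Y q) + cutSize G₁ Y)
    extend = extension , extension-merge , (begin
      cutSize H extension
        ≡⟨ cutSize-H extension ⟩
      sep (extension p) (extension v) + (sep (extension q) (extension v) + cutSize G₁ (extension ∘ merge))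
        ≡⟨ cong₂ _+_ (sep-≡ (trans (extension-≢ p≢v) (sym extension-v)))
             (cong₂ _+_ (trans (cong₂ sep (extension-≢ q≢v) extension-v) (sep-comm (Y q) (Y p)))
                        (cutSize-cong G₁ extension-merge)) ⟩
      sep (Y p) (Y q) + cutSize G₁ Y ∎)
      where open ≡-Reasoning

  tight-H : ∀ i → ∃[ X ] (Crosses X (lookup H i) × cutSize H X ≤ 2)
  tight-H zero          = ⁅ v ⁆ᶜ , ⁅v⁆-separates p≢v , ⁅v⁆-tight
  tight-H (suc zero)    = ⁅ v ⁆ᶜ , ⁅v⁆-separates q≢v , ⁅v⁆-tight
  tight-H (suc (suc i)) with origin G₁ i
  ... | j , eq₁ , eq₂ with still-tight j (λ eq → noLoop (lookup (contract G₁) i) (trans eq₁ (trans eq (sym eq₂))))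
  ...   | Y , Yu≡Yv , crosses , ≤2 with extend Y Yu≡Yv
  ...     | X , X∘merge , size = X
    , (λ eq → crosses (trans (sym (X∘merge _)) (trans (cong X (sym eq₁)) (trans eq (trans (cong X eq₂) (X∘merge _))))))
    , subst (_≤ 2) (sym size) ≤2

  minTwoEC-H : MinTwoEC H
  minTwoEC-H = record { twoEC = twoEC-H ; tight = tight-H }

  merged-connected : ∀ {k a b} → EdgeConnected G k a b → EdgeConnected H k (merge a) (merge b)
  merged-connected conn X X≢ = ≤-trans (conn (X ∘ merge) X≢) (cutSize-H-≥ X)

  module _ {L′} (cuts : LocalCuts H L′) where

    open LocalCuts cuts using () renaming (greatest to greatest′; symmetric to symmetric′)

    L≤L′ : ∀ {a b} → a ≢ b → merge a ≢ merge b → L a b ≤ L′ (merge a) (merge b)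
    L≤L′ a≢b ma≢mb = greatest′ _ _ ma≢mb (merged-connected (connected _ _ a≢b))

    2≤L′ : ∀ {a b} → a ≢ b → 2 ≤ L′ a b
    2≤L′ a≢b = greatest′ _ _ a≢b λ X X≢ → twoEC-H X (_ , _ , X≢)

    private
      away : ∀ a b → a ≢ b → a ≢ u → a ≢ v → b ≢ u → b ≢ v → L a b ≤ L′ a b
      away a b a≢b _ a≢v _ b≢v = subst₂ (λ x y → L a b ≤ L′ x y) (merge-≢ a≢v) (merge-≢ b≢v)
        (L≤L′ a≢b λ eq → a≢b (trans (sym (merge-≢ a≢v)) (trans eq (merge-≢ b≢v))))

      to-u : ∀ {a w} → a ≢ u → a ≢ v → a ≢ w → merge w ≡ u → L a w ≤ L′ a u
      to-u a≢u a≢v a≢w mw≡u = subst₂ (λ x y → L _ _ ≤ L′ x y) (merge-≢ a≢v) mw≡u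
        (L≤L′ a≢w λ eq → a≢u (trans (sym (merge-≢ a≢v)) (trans eq mw≡u)))

      side : ∀ a → X₀ a ≢ X₀ u ⊎ X₀ a ≢ X₀ v
      side a with X₀ a Bool.≟ X₀ u
      ... | yes a≡u = inj₂ λ a≡v → X₀-uv (trans (sym a≡u) a≡v)
      ... | no a≢u  = inj₁ a≢u

      -- The end of uv beyond `X₀`, seen from `a`, contributes at most 2, which the new vertex `v`
      -- matches; the value at the other end is inherited by the merged vertex `u`.
      pair : ∀ a → a ≢ u → a ≢ v → L a u + L a v ≤ L′ a u + L′ a v
      pair a a≢u a≢v with side a
      ... | inj₁ X₀≢ = subst (_≤ L′ a u + L′ a v) (+-comm (L a v) (L a u))
                         (+-mono-≤ (to-u a≢u a≢v a≢v merge-v) (≤-trans (separated-≤2 opt X₀-tight X₀≢) (2≤L′ a≢v)))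
      ... | inj₂ X₀≢ = +-mono-≤ (to-u a≢u a≢v a≢u merge-u) (≤-trans (separated-≤2 opt X₀-tight X₀≢) (2≤L′ a≢v))

      joint : L u v ≤ L′ u v
      joint = ≤-trans (separated-≤2 opt X₀-tight X₀-uv) (2≤L′ u≢v)

      open Compare symmetric symmetric′ u≢v away pair joint

    -- Since nothing is lost in total, `H` is optimal too, and everything proved about optimal
    -- graphs can be applied to it again.
    optimal-H : Optimal H L′
    optimal-H = record
      { minTwoEC  = minTwoEC-H
      ; localCuts = cuts
      ; best      = λ K K-min L″ cuts″ → ≤-trans (best K K-min L″ cuts″) total-≤
      }

    no-gain-away : ∀ {a b} → a ≢ b → a ≢ u → a ≢ v → b ≢ u → b ≢ v → ¬ (L a b < L′ a b)
    no-gain-away a≢b a≢u a≢v b≢u b≢v gain =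
      <⇒≱ (total-<-away _ _ a≢b a≢u a≢v b≢u b≢v gain) (best H minTwoEC-H L′ cuts)

    -- Which of `L a u` and `L a v` the merged vertex inherits depends on the side of `a`, so
    -- `L′ a u` is required to exceed both.
    no-gain-merged : ∀ {a} → a ≢ u → a ≢ v → L a u < L′ a u → L a v < L′ a u → ⊥
    no-gain-merged {a} a≢u a≢v gain-u gain-v = <⇒≱ (total-<-pair a a≢u a≢v gain) (best H minTwoEC-H L′ cuts)
      where
      gain : L a u + L a v < L′ a u + L′ a v
      gain with side a
      ... | inj₁ X₀≢ = subst (_< L′ a u + L′ a v) (+-comm (L a v) (L a u))
                         (+-mono-<-≤ gain-v (≤-trans (separated-≤2 opt X₀-tight X₀≢) (2≤L′ a≢v)))
      ... | inj₂ X₀≢ = +-mono-<-≤ gain-u (≤-trans (separated-≤2 opt X₀-tight X₀≢) (2≤L′ a≢v))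

-- Two-edge cuts of an optimal graph

Joins-sym : ∀ {n} {e : Edge n} {u v} → Joins e u v → Joins e v u
Joins-sym (inj₁ (p , q)) = inj₂ (p , q)
Joins-sym (inj₂ (p , q)) = inj₁ (p , q)

Joins-ends : ∀ {n} {e f : Edge n} {u v} → Joins e u v → Joins f u v → Joins f (end₁ e) (end₂ e)
Joins-ends         (inj₁ (refl , refl)) j = j
Joins-ends {f = f} (inj₂ (refl , refl)) j = Joins-sym {e = f} j

Joins-≢ : ∀ {n} {e : Edge n} {u v} → Joins e u v → u ≢ v
Joins-≢ {e = e} (inj₁ (refl , refl)) eq = noLoop e eq
Joins-≢ {e = e} (inj₂ (refl , refl)) eq = noLoop e (sym eq)

separation-Joins : ∀ {n} {e : Edge n} {u v} (X : Cut n) → Joins e u v → separation X e ≡ sep (X u) (X v)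
separation-Joins         X (inj₁ (refl , refl)) = refl
separation-Joins {e = e} X (inj₂ (refl , refl)) = sep-comm (X (end₁ e)) (X (end₂ e))

crosses⇒≢ : ∀ {n} {e : Edge n} {u v} {X : Cut n} → Joins e u v → Crosses X e → X u ≢ X v
crosses⇒≢ (inj₁ (refl , refl)) c = c
crosses⇒≢ (inj₂ (refl , refl)) c = c ∘ sym

≢⇒crosses : ∀ {n} {e : Edge n} {u v} {X : Cut n} → Joins e u v → X u ≢ X v → Crosses X e
≢⇒crosses (inj₁ (refl , refl)) c = c
≢⇒crosses (inj₂ (refl , refl)) c = c ∘ sym

uncrossed⇒≡ : ∀ {n} {e : Edge n} {u v} {X : Cut n} → Joins e u v → ¬ Crosses X e → X u ≡ X v
uncrossed⇒≡ {e = e} {u = u} {v} {X} j ¬c = decidable-stable (X u Bool.≟ X v) λ ≢ → ¬c (≢⇒crosses {e = e} {X = X} j ≢)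

three-crossings : ∀ {n} (G : Graph n) {X i j k} → i ≢ j → i ≢ k → j ≢ k →
  Crosses X (lookup G i) → Crosses X (lookup G j) → Crosses X (lookup G k) → 3 ≤ cutSize G X
three-crossings G {X} {i} {j} {k} i≢j i≢k j≢k ci cj ck = injection⇒≤cutSize G X f inj crosses
  where
  f : Fin 3 → Fin (length G)
  f zero             = i
  f (suc zero)       = j
  f (suc (suc zero)) = k
  inj : ∀ a b → f a ≡ f b → a ≡ b
  inj zero             zero             _  = refl
  inj zero             (suc zero)       eq = contradiction eq i≢j
  inj zero             (suc (suc zero)) eq = contradiction eq i≢k
  inj (suc zero)       zero             eq = contradiction (sym eq) i≢j
  inj (suc zero)       (suc zero)       _  = refl
  inj (suc zero)       (suc (suc zero)) eq = contradiction eq j≢k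
  inj (suc (suc zero)) zero             eq = contradiction (sym eq) i≢k
  inj (suc (suc zero)) (suc zero)       eq = contradiction (sym eq) j≢k
  inj (suc (suc zero)) (suc (suc zero)) _  = refl
  crosses : ∀ a → Crosses X (lookup G (f a))
  crosses zero             = ci
  crosses (suc zero)       = cj
  crosses (suc (suc zero)) = ck

cutSize-xor : ∀ {n} (G : Graph n) (X Y : Cut n) → cutSize G (λ x → X x xor Y x) ≤ cutSize G X + cutSize G Y
cutSize-xor []      X Y = z≤n
cutSize-xor (e ∷ G) X Y = ≤-trans (+-mono-≤ (edge (X (end₁ e)) (X (end₂ e)) (Y (end₁ e)) (Y (end₂ e))) (cutSize-xor G X Y))
  (≤-reflexive (interchange (separation X e) (separation Y e) (cutSize G X) (cutSize G Y)))
  where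
  edge : ∀ x x′ y y′ → sep (x xor y) (x′ xor y′) ≤ sep x x′ + sep y y′
  edge true  true  true  true  = z≤n
  edge true  true  true  false = ≤-refl
  edge true  true  false true  = ≤-refl
  edge true  true  false false = z≤n
  edge false false true  true  = z≤n
  edge false false true  false = ≤-refl
  edge false false false true  = ≤-refl
  edge false false false false = z≤n
  edge true  false true  true  = ≤-refl
  edge true  false true  false = z≤n
  edge true  false false true  = z≤n
  edge true  false false false = ≤-refl
  edge false true  true  true  = ≤-refl
  edge false true  true  false = z≤n
  edge false true  false true  = z≤n
  edge false true  false false = ≤-refl

xor-≢-≢ : ∀ {x x′ y y′} → x ≢ x′ → y ≢ y′ → x xor y ≡ x′ xor y′
xor-≢-≢ {true}  {true}  x≢ y≢ = contradiction refl x≢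
xor-≢-≢ {false} {false} x≢ y≢ = contradiction refl x≢
xor-≢-≢ {true}  {false} x≢ y≢ = sym (¬-not (y≢ ∘ sym))
xor-≢-≢ {false} {true}  x≢ y≢ = ¬-not y≢

xor-≡-≢ : ∀ {x x′ y y′} → x ≡ x′ → y ≢ y′ → x xor y ≢ x′ xor y′
xor-≡-≢ {true}  refl y≢ eq = y≢ (Bool.not-injective eq)
xor-≡-≢ {false} refl y≢ eq = y≢ eq

-- In the symmetric difference the common edge `i` cancels, and each of the two cuts contributes at
-- most one further edge.
xor-tight : ∀ {n} (G : Graph n) {X Y i} → Crosses X (lookup G i) → Crosses Y (lookup G i) →
  cutSize G X ≤ 2 → cutSize G Y ≤ 2 → cutSize G (λ x → X x xor Y x) ≤ 2
xor-tight G {X} {Y} {i} cX cY X≤2 Y≤2 = begin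
  cutSize G X⊕Y                                 ≡⟨ cutSize-∖⁅⁆ G i X⊕Y ⟩
  separation X⊕Y (lookup G i) + cutSize G′ X⊕Y  ≡⟨ cong (_+ cutSize G′ X⊕Y) (sep-≡ (xor-≢-≢ cX cY)) ⟩
  cutSize G′ X⊕Y                                ≤⟨ cutSize-xor G′ X Y ⟩
  cutSize G′ X + cutSize G′ Y                   ≤⟨ +-mono-≤ (others cX X≤2) (others cY Y≤2) ⟩
  2                                             ∎
  where
  open ≤-Reasoning
  X⊕Y = λ x → X x xor Y x
  G′ = G ∖ ⁅ i ⁆
  others : ∀ {Z} → Crosses Z (lookup G i) → cutSize G Z ≤ 2 → cutSize G′ Z ≤ 1
  others {Z} c ≤2 = +-cancelˡ-≤ 1 _ _ (subst (_≤ 2) (trans (cutSize-∖⁅⁆ G i Z) (cong (_+ cutSize G′ Z) (sep-≢ c))) ≤2)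

module _ {n} {G : Graph n} {L} (opt : Optimal G L) where

  open Optimal opt

  -- Contracting e costs at most 2(n − 1); a path a–v–b through the vertex v thus
  -- set free regains this and raises λ(a,b) as well.
  no-spare-contraction : ∀ {a b} → a ≢ b → 3 ≤ L a b → ∀ i →
    ¬ (∀ j → ¬ Joins (lookup G j) (end₁ (lookup G i)) (end₂ (lookup G i)) →
         ∃[ Y ] (Y (end₁ (lookup G i)) ≡ Y (end₂ (lookup G i)) × Crosses Y (lookup G j) × cutSize G Y ≤ 2))
  no-spare-contraction {a₀} {b₀} a₀≢b₀ 3≤L i others = localCuts-exist H contra
    where
    e = lookup G i
    u = end₁ e
    v = end₂ e
    u≢v = noLoop e
    X₀ = proj₁ (tight i)
    X₀-uv = proj₁ (proj₂ (tight i))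
    X₀-tight = proj₂ (proj₂ (tight i))
    open Contraction u v

    -- Since λ(a₀,b₀) ≥ 3, no 2-edge cut separates `a₀` and `b₀`; the new path between them
    -- therefore adds nothing to the cuts that witness minimality.
    glued : ∀ {Y} → cutSize G Y ≤ 2 → Y a₀ ≡ Y b₀
    glued ≤2 = decidable-stable (_ Bool.≟ _) λ ≢ → <⇒≱ 3≤L (separated-≤2 opt ≤2 ≢)

    still-tight : ∀ j → merge (end₁ (lookup G j)) ≢ merge (end₂ (lookup G j)) →
      ∃[ Y ] (Y u ≡ Y v × Crosses Y (lookup G j) × sep (Y (merge a₀)) (Y (merge b₀)) + cutSize G Y ≤ 2)
    still-tight j ≢ with others j ¬joins
      where
      ¬joins : ¬ Joins (lookup G j) u v
      ¬joins (inj₁ (e₁ , e₂)) = ≢ (trans (cong merge e₁) (trans merge-u (sym (trans (cong merge e₂) merge-v))))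
      ¬joins (inj₂ (e₁ , e₂)) = ≢ (trans (cong merge e₁) (trans merge-v (sym (trans (cong merge e₂) merge-u))))
    ... | Y , Yu≡Yv , c , ≤2 = Y , Yu≡Yv , c
      , subst (λ s → s + cutSize G Y ≤ 2) (sym (sep-≡ (trans (∘merge {Y} Yu≡Yv a₀) (trans (glued ≤2) (sym (∘merge {Y} Yu≡Yv b₀)))))) ≤2

    -- Here `G₁` is `G` itself: the path through `v` replaces no edge and is a pure gain. Its ends
    -- are merged because `a₀` or `b₀` may be `v`.
    open Move opt u≢v X₀ X₀-uv X₀-tight (merge-≢v u≢v a₀) (merge-≢v u≢v b₀) G (λ Y _ → m≤n+m _ _) still-tight
      using (H; no-gain-away; no-gain-merged; cutSize-H-≥₁)

    contra : ¬ (∃[ L′ ] LocalCuts H L′)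
    contra (L′ , cuts) = cases (a₀ ≟ u) (a₀ ≟ v) (b₀ ≟ u) (b₀ ≟ v)
      where
      open LocalCuts cuts using () renaming (greatest to greatest′; symmetric to symmetric′)

      gain : merge a₀ ≢ merge b₀ → L a₀ b₀ < L′ (merge a₀) (merge b₀)
      gain m≢m = greatest′ _ _ m≢m λ X X≢ → ≤-trans
        (+-mono-≤ (≤-reflexive (sym (sep-≢ X≢))) (connected a₀ b₀ a₀≢b₀ (X ∘ merge) X≢)) (cutSize-H-≥₁ X)

      far-side : ∀ {x y c} → X₀ x ≢ X₀ y → 3 ≤ L c x → L c y ≤ 2
      far-side {x} {y} {c} x≢y 3≤ = separated-≤2 opt X₀-tight λ c≡y →
        <⇒≱ 3≤ (separated-≤2 opt X₀-tight λ c≡x → x≢y (trans (sym c≡x) c≡y))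

      -- This treats the case that exactly one of `a₀`, `b₀` is an end `w` of the contracted edge.
      -- From λ(c,w) ≥ 3 it follows that the other end `w′` lies beyond `X₀`, so λ(c,w′) ≤ 2 is
      -- exceeded as well.
      one-merged : ∀ {c w w′} → c ≢ u → c ≢ v → X₀ w ≢ X₀ w′ → merge w ≡ u →
        (w ≡ u × w′ ≡ v) ⊎ (w ≡ v × w′ ≡ u) → 3 ≤ L c w → (merge c ≢ merge w → L c w < L′ (merge c) (merge w)) → ⊥
      one-merged {c} {w} {w′} c≢u c≢v X₀≢ mw≡u which 3≤ gain = conclude which
        where
        gain′ : L c w < L′ c u
        gain′ = subst₂ (λ x y → L c w < L′ x y) (merge-≢ c≢v) mw≡u
          (gain λ eq → c≢u (trans (sym (merge-≢ c≢v)) (trans eq mw≡u)))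
        other : L c w′ < L′ c u
        other = ≤-<-trans (far-side X₀≢ 3≤) (<-trans 3≤ gain′)
        conclude : (w ≡ u × w′ ≡ v) ⊎ (w ≡ v × w′ ≡ u) → ⊥
        conclude (inj₁ (refl , refl)) = no-gain-merged cuts c≢u c≢v gain′ other
        conclude (inj₂ (refl , refl)) = no-gain-merged cuts c≢u c≢v other gain′

      3≤L′ : 3 ≤ L b₀ a₀
      3≤L′ = subst (3 ≤_) (symmetric a₀ b₀ a₀≢b₀) 3≤L

      gain-sym : merge b₀ ≢ merge a₀ → L b₀ a₀ < L′ (merge b₀) (merge a₀)
      gain-sym ≢ = subst₂ _<_ (symmetric a₀ b₀ a₀≢b₀) (symmetric′ _ _ (≢ ∘ sym)) (gain (≢ ∘ sym))

      cases : Dec (a₀ ≡ u) → Dec (a₀ ≡ v) → Dec (b₀ ≡ u) → Dec (b₀ ≡ v) → ⊥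
      cases (yes refl) _          (yes refl) _          = a₀≢b₀ refl
      cases (yes refl) _          (no _)     (yes refl) = <⇒≱ 3≤L (separated-≤2 opt X₀-tight X₀-uv)
      cases (yes refl) _          (no b≢u)   (no b≢v)   = one-merged b≢u b≢v X₀-uv merge-u (inj₁ (refl , refl)) 3≤L′ gain-sym
      cases (no _)     (yes refl) (yes refl) _          = <⇒≱ 3≤L (separated-≤2 opt X₀-tight (X₀-uv ∘ sym))
      cases (no _)     (yes refl) (no _)     (yes refl) = a₀≢b₀ refl
      cases (no _)     (yes refl) (no b≢u)   (no b≢v)   = one-merged b≢u b≢v (X₀-uv ∘ sym) merge-v (inj₂ (refl , refl)) 3≤L′ gain-sym
      cases (no a≢u)   (no a≢v)   (yes refl) _          = one-merged a≢u a≢v X₀-uv merge-u (inj₁ (refl , refl)) 3≤L gain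
      cases (no a≢u)   (no a≢v)   (no _)     (yes refl) = one-merged a≢u a≢v (X₀-uv ∘ sym) merge-v (inj₂ (refl , refl)) 3≤L gain
      cases (no a≢u)   (no a≢v)   (no b≢u)   (no b≢v)   = no-gain-away cuts a₀≢b₀ a≢u a≢v b≢u b≢v
        (subst₂ (λ x y → L a₀ b₀ < L′ x y) (merge-≢ a≢v) (merge-≢ b≢v)
          (gain λ eq → a₀≢b₀ (trans (sym (merge-≢ a≢v)) (trans eq (merge-≢ b≢v)))))

-- Then {i, j} is the only 2-edge cut containing i or j.
record Partner {n} (G : Graph n) (i j : Fin (length G)) : Set where
  field
    nonparallel : ¬ Joins (lookup G j) (end₁ (lookup G i)) (end₂ (lookup G i))
    to          : ∀ {X} → cutSize G X ≤ 2 → Crosses X (lookup G i) → Crosses X (lookup G j)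
    from        : ∀ {X} → cutSize G X ≤ 2 → Crosses X (lookup G j) → Crosses X (lookup G i)

  distinct : i ≢ j
  distinct refl = nonparallel (inj₁ (refl , refl))

  only : ∀ {X} → cutSize G X ≤ 2 → Crosses X (lookup G i) → ∀ {k} → Crosses X (lookup G k) → k ≢ i → k ≡ j
  only X≤2 ci {k} ck k≢i = decidable-stable (k ≟ j) λ k≢j →
    <⇒≱ (three-crossings G distinct (k≢i ∘ sym) (k≢j ∘ sym) ci (to X≤2 ci) ck) X≤2

-- Suppose that `j` is not parallel to `i` and that every 2-edge cut through `j` contains `i`. If
-- some 2-edge cut through `i` missed `j`, its symmetric difference with one through `j` would be a
-- 2-edge cut through `j` without `i`. So a `j` that is no partner has a 2-edge cut avoiding `i`,
-- and without any partner `i` could be contracted.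
partner-exists : ∀ {n} {G : Graph n} {L} → Optimal G L → ∀ {a b} → a ≢ b → 3 ≤ L a b → ∀ i → ¬ (∀ j → ¬ Partner G i j)
partner-exists {n} {G} opt a≢b 3≤L i none = ¬¬-finite tight-off (no-spare-contraction opt a≢b 3≤L i)
  where
  open Optimal opt
  u = end₁ (lookup G i)
  v = end₂ (lookup G i)
  TightOff : Fin (length G) → Set
  TightOff j = ∃[ Y ] (Y u ≡ Y v × Crosses Y (lookup G j) × cutSize G Y ≤ 2)
  tight-off : ∀ j → ¬ ¬ (¬ Joins (lookup G j) u v → TightOff j)
  tight-off j k = ¬¬-excluded-middle {A = Joins (lookup G j) u v} λ where
      (yes joins) → k (λ ¬joins → contradiction joins ¬joins)
      (no ¬joins) → none j record { nonparallel = ¬joins ; to = to ; from = from }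
    where
    ¬tight-off : ¬ TightOff j
    ¬tight-off t = k λ _ → t
    from : ∀ {X} → cutSize G X ≤ 2 → Crosses X (lookup G j) → Crosses X (lookup G i)
    from {X} X≤2 c Xu≡Xv = ¬tight-off (X , Xu≡Xv , c , X≤2)
    to : ∀ {X} → cutSize G X ≤ 2 → Crosses X (lookup G i) → Crosses X (lookup G j)
    to {X} X≤2 c ¬c = let Y , cY , Y≤2 = tight j in
      ¬tight-off ((λ x → X x xor Y x) , xor-≢-≢ c (from Y≤2 cY) , xor-≡-≢ ¬c cY , xor-tight G c (from Y≤2 cY) X≤2 Y≤2)

-- Partners and their common ends

∣p∪q∣≤∣p∣+∣q∣ : ∀ {n} (p q : Subset n) → ∣ p ∪ q ∣ ≤ ∣ p ∣ + ∣ q ∣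
∣p∪q∣≤∣p∣+∣q∣ Vec.[]              Vec.[]              = z≤n
∣p∪q∣≤∣p∣+∣q∣ (inside  Vec.∷ p)   (inside  Vec.∷ q)   = s≤s (≤-trans (∣p∪q∣≤∣p∣+∣q∣ p q) (+-monoʳ-≤ ∣ p ∣ (n≤1+n ∣ q ∣)))
∣p∪q∣≤∣p∣+∣q∣ (inside  Vec.∷ p)   (outside Vec.∷ q)   = s≤s (∣p∪q∣≤∣p∣+∣q∣ p q)
∣p∪q∣≤∣p∣+∣q∣ (outside Vec.∷ p)   (inside  Vec.∷ q)   = ≤-trans (s≤s (∣p∪q∣≤∣p∣+∣q∣ p q)) (≤-reflexive (sym (+-suc ∣ p ∣ ∣ q ∣)))
∣p∪q∣≤∣p∣+∣q∣ (outside Vec.∷ p)   (outside Vec.∷ q)   = ∣p∪q∣≤∣p∣+∣q∣ p q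

∈-∖⁺ : ∀ {n} (G : Graph n) S {i} → i ∉ˢ S → ∃[ j ] lookup (G ∖ S) j ≡ lookup G i
∈-∖⁺ (e ∷ G) (inside  Vec.∷ S) {zero}  i∉ = contradiction Vec.here i∉
∈-∖⁺ (e ∷ G) (outside Vec.∷ S) {zero}  i∉ = zero , refl
∈-∖⁺ (e ∷ G) (inside  Vec.∷ S) {suc i} i∉ = ∈-∖⁺ G S (i∉ ∘ Vec.there)
∈-∖⁺ (e ∷ G) (outside Vec.∷ S) {suc i} i∉ = let j , eq = ∈-∖⁺ G S (i∉ ∘ Vec.there) in suc j , eq

Joins-unique : ∀ {n} {e : Edge n} {u v w} → Joins e u v → Joins e u w → v ≡ w
Joins-unique         (inj₁ (refl , refl)) (inj₁ (refl , refl)) = refl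
Joins-unique {e = e} (inj₁ (refl , refl)) (inj₂ (refl , eq))   = contradiction (sym eq) (noLoop e)
Joins-unique {e = e} (inj₂ (refl , refl)) (inj₁ (eq , refl))   = contradiction eq (noLoop e)
Joins-unique         (inj₂ (refl , refl)) (inj₂ (refl , refl)) = refl

Joins-both : ∀ {n} {e : Edge n} {u v w w′} → u ≢ v → Joins e u w → Joins e v w′ → Joins e u v
Joins-both u≢v (inj₁ (refl , refl)) (inj₁ (eq , refl)) = contradiction eq u≢v
Joins-both u≢v (inj₁ (refl , refl)) (inj₂ (refl , eq)) = inj₁ (refl , eq)
Joins-both u≢v (inj₂ (refl , refl)) (inj₁ (refl , eq)) = inj₂ (refl , refl)
Joins-both u≢v (inj₂ (refl , refl)) (inj₂ (refl , eq)) = contradiction eq u≢v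

crosses-⁅⁆⇒Joins : ∀ {n} (e : Edge n) u → Crosses ⁅ u ⁆ᶜ e → ∃[ w ] Joins e u w
crosses-⁅⁆⇒Joins e u c with end₁ e ≟ u | end₂ e ≟ u
... | yes eq | _      = end₂ e , inj₁ (eq , refl)
... | no _   | yes eq = end₁ e , inj₂ (refl , eq)
... | no _   | no _   = contradiction refl c

third-crossing : ∀ {n} (G : Graph n) X i j → 3 ≤ cutSize G X →
  ¬ (∀ k → k ≢ i → k ≢ j → ¬ Crosses X (lookup G k))
third-crossing G X i j 3≤ none = <⇒≱ 3≤ (begin
  cutSize G X                  ≤⟨ cutSize-∖ G S X ⟩
  cutSize (G ∖ S) X + ∣ S ∣    ≡⟨ cong (_+ ∣ S ∣) (cutSize-∖-covered G S X covered) ⟩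
  ∣ S ∣                        ≤⟨ ∣p∪q∣≤∣p∣+∣q∣ ⁅ i ⁆ ⁅ j ⁆ ⟩
  ∣ ⁅ i ⁆ ∣ + ∣ ⁅ j ⁆ ∣        ≡⟨ cong₂ _+_ (∣⁅x⁆∣≡1 i) (∣⁅x⁆∣≡1 j) ⟩
  2                            ∎)
  where
  open ≤-Reasoning
  S = ⁅ i ⁆ ∪ ⁅ j ⁆
  covered : ∀ k → Crosses X (lookup G k) → k ∈ˢ S
  covered k c with k ≟ i | k ≟ j
  ... | yes refl | _        = p⊆p∪q ⁅ j ⁆ (x∈⁅x⁆ i)
  ... | no _     | yes refl = q⊆p∪q ⁅ i ⁆ ⁅ j ⁆ (x∈⁅x⁆ j)
  ... | no k≢i   | no k≢j   = contradiction c (none k k≢i k≢j)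

module _ {n} {G : Graph n} {i j} (partner : Partner G i j) where

  open Partner partner

  -- A cut containing exactly one of two partners has a third edge; the bounds λ ≥ 3 derived from
  -- partners rest on this.
  cut-one-≥3 : ∀ {Y} → ¬ Crosses Y (lookup G i) → Crosses Y (lookup G j) → 3 ≤ cutSize G Y
  cut-one-≥3 ¬ci cj = ≰⇒> λ Y≤2 → ¬ci (from Y≤2 cj)

  cut-other-≥3 : ∀ {Y} → Crosses Y (lookup G i) → ¬ Crosses Y (lookup G j) → 3 ≤ cutSize G Y
  cut-other-≥3 ci ¬cj = ≰⇒> λ Y≤2 → ¬cj (to Y≤2 ci)

  not-parallel : ∀ {u v} → Joins (lookup G i) u v → ¬ Joins (lookup G j) u v
  not-parallel ji jj = nonparallel (Joins-ends {e = lookup G i} {f = lookup G j} ji jj)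

¬crosses : ∀ {n} {e : Edge n} {u v} {X : Cut n} → Joins e u v → X u ≡ X v → ¬ Crosses X e
¬crosses {e = e} {X = X} j eq c = crosses⇒≢ {e = e} {X = X} j c eq

-- Contract i and subdivide its partner j.
module PairMove {n} {G : Graph n} {L} (opt : Optimal G L) {i j} (partner : Partner G i j)
  {u v p q} (i-joins : Joins (lookup G i) u v) (j-joins : Joins (lookup G j) p q) where

  open Optimal opt
  open Partner partner
  open Contraction u v public

  private
    e = lookup G i
    f = lookup G j
    u≢v = Joins-≢ {e = e} i-joins
    X₀ = proj₁ (tight i)
    X₀-e = proj₁ (proj₂ (tight i))
    X₀-tight = proj₂ (proj₂ (tight i))
    G₁ = G ∖ ⁅ j ⁆

  cutSize-G : ∀ Y → Y u ≡ Y v → cutSize G Y ≡ sep (Y (merge p)) (Y (merge q)) + cutSize G₁ Y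
  cutSize-G Y Yu≡Yv = trans (cutSize-∖⁅⁆ G j Y) (cong (_+ cutSize G₁ Y)
    (trans (separation-Joins {e = f} Y j-joins) (sym (cong₂ sep (∘merge {Y} Yu≡Yv p) (∘merge {Y} Yu≡Yv q)))))

  still-tight : ∀ k → merge (end₁ (lookup G₁ k)) ≢ merge (end₂ (lookup G₁ k)) →
    ∃[ Y ] (Y u ≡ Y v × Crosses Y (lookup G₁ k) × sep (Y (merge p)) (Y (merge q)) + cutSize G₁ Y ≤ 2)
  still-tight k survives with ∈-∖ G ⁅ j ⁆ (∈-lookup k)
  ... | l , l∉ , eq = Y , Yu≡Yv , subst (Crosses Y) eq c , subst (_≤ 2) (cutSize-G Y Yu≡Yv) Y≤2
    where
    Y = proj₁ (tight l)
    c = proj₁ (proj₂ (tight l))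
    Y≤2 = proj₂ (proj₂ (tight l))
    merged : ∀ {g} → Joins g u v → merge (end₁ g) ≡ merge (end₂ g)
    merged (inj₁ (refl , refl)) = trans merge-u (sym merge-v)
    merged (inj₂ (refl , refl)) = trans merge-v (sym merge-u)
    l≢i : l ≢ i
    l≢i refl = survives (subst (λ g → merge (end₁ g) ≡ merge (end₂ g)) eq (merged {e} i-joins))
    -- A 2-edge cut through `i` consists of `i` and `j`. As `l` is neither of them, its cut does not
    -- separate `u` and `v`, and survives the contraction.
    Yu≡Yv : Y u ≡ Y v
    Yu≡Yv = uncrossed⇒≡ {e = e} {X = Y} i-joins λ ci →
      l∉ (subst (_∈ˢ ⁅ j ⁆) (sym (only Y≤2 ci c l≢i)) (x∈⁅x⁆ j))

  private
    module M = Move opt u≢v X₀ (crosses⇒≢ {e = e} {X = X₀} i-joins X₀-e) X₀-tight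
      (merge-≢v u≢v p) (merge-≢v u≢v q) G₁ (λ Y eq → ≤-reflexive (cutSize-G Y eq)) still-tight

  open M public using (H; cutSize-H-≥; optimal-H)

  preserved-cut : ∀ Y → Y u ≡ Y v → ∃[ X ] ((∀ x → X (merge x) ≡ Y x) × cutSize H X ≡ cutSize G Y)
  preserved-cut Y Yu≡Yv = let X , X∘merge , size = M.extend Y Yu≡Yv in X , X∘merge , trans size (sym (cutSize-G Y Yu≡Yv))

  -- The cut `Y` certifies that the edge does not become a loop: it separates the ends of the edge
  -- but not `u` from `v`.
  preserved-edge : ∀ {Y k x y} → Y u ≡ Y v → Joins (lookup G k) x y → Y x ≢ Y y → k ≢ j →
    ∃[ l ] Joins (lookup H l) (merge x) (merge y)
  preserved-edge {Y} {k} {x} {y} Yu≡Yv joins Yx≢Yy k≢j with ∈-∖⁺ G ⁅ j ⁆ (k≢j ∘ x∈⁅y⁆⇒x≡y j)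
  ... | l , eq with image G₁ l survives
    where
    survives : merge (end₁ (lookup G₁ l)) ≢ merge (end₂ (lookup G₁ l))
    survives meq = ≢⇒crosses {e = lookup G₁ l} {X = Y} (subst (λ g → Joins g x y) (sym eq) joins) Yx≢Yy
      (trans (sym (∘merge {Y} Yu≡Yv _)) (trans (cong Y meq) (∘merge {Y} Yu≡Yv _)))
  ... | m , eq₁ , eq₂ = suc (suc m) , moved (subst (λ g → Joins g x y) (sym eq) joins)
    where
    moved : Joins (lookup G₁ l) x y → Joins (lookup (contract G₁) m) (merge x) (merge y)
    moved (inj₁ (e₁ , e₂)) = inj₁ (trans eq₁ (cong merge e₁) , trans eq₂ (cong merge e₂))
    moved (inj₂ (e₁ , e₂)) = inj₂ (trans eq₁ (cong merge e₁) , trans eq₂ (cong merge e₂))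

  -- By `far`, a 2-edge cut through `e` separates `a` from `b`, so λ(a,b) ≤ 2 in `G`. After the move
  -- only cuts that do not separate `u` and `v` matter; if all of these between `a` and `b` had
  -- three edges, λ(a,b) would rise.
  no-far-link : ∀ {a b} → a ≢ u → a ≢ v → b ≢ u → b ≢ v →
    (∀ {X} → cutSize G X ≤ 2 → Crosses X e → X a ≢ X b) →
    ¬ (∀ Y → Y u ≡ Y v → Y a ≢ Y b → 3 ≤ cutSize G Y)
  no-far-link {a} {b} a≢u a≢v b≢u b≢v far link = localCuts-exist H λ (L′ , cuts) →
    M.no-gain-away cuts a≢b a≢u a≢v b≢u b≢v (≤-trans (s≤s (separated-≤2 opt X₀-tight X₀a≢X₀b))
      (LocalCuts.greatest cuts a b a≢b λ X X≢ → ≤-trans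
        (link (X ∘ merge) (cong X (trans merge-u (sym merge-v)))
          (subst₂ (λ x y → X x ≢ X y) (sym (merge-≢ a≢v)) (sym (merge-≢ b≢v)) X≢))
        (cutSize-H-≥ X)))
    where
    X₀a≢X₀b = far X₀-tight X₀-e
    a≢b : a ≢ b
    a≢b eq = X₀a≢X₀b (cong X₀ eq)

module _ {n} {G : Graph n} {L} (opt : Optimal G L) where

  open Optimal opt

  -- If the partners had no common end, contracting `i` would raise λ between the ends of `j`: the
  -- remaining cuts between them contain `j` but not `i`.
  share-end : ∀ {i j} → Partner G i j → ∀ {u v} → Joins (lookup G i) u v →
    (∃[ w ] Joins (lookup G j) u w) ⊎ (∃[ w ] Joins (lookup G j) v w)
  share-end {i} {j} partner {u} {v} i-joins = cases (p ≟ u) (p ≟ v) (q ≟ u) (q ≟ v)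
    where
    f = lookup G j
    p = end₁ f
    q = end₂ f
    cases : Dec (p ≡ u) → Dec (p ≡ v) → Dec (q ≡ u) → Dec (q ≡ v) → (∃[ w ] Joins f u w) ⊎ (∃[ w ] Joins f v w)
    cases (yes eq) _        _        _        = inj₁ (q , inj₁ (eq , refl))
    cases (no _)   (yes eq) _        _        = inj₂ (q , inj₁ (eq , refl))
    cases (no _)   (no _)   (yes eq) _        = inj₁ (p , inj₂ (refl , eq))
    cases (no _)   (no _)   (no _)   (yes eq) = inj₂ (p , inj₂ (refl , eq))
    cases (no p≢u) (no p≢v) (no q≢u) (no q≢v) = contradiction
      (λ Y Yu≡Yv Yp≢Yq → cut-one-≥3 partner {Y} (¬crosses {e = lookup G i} {X = Y} i-joins Yu≡Yv) Yp≢Yq)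
      (PairMove.no-far-link opt partner i-joins (inj₁ (refl , refl)) p≢u p≢v q≢u q≢v (Partner.to partner))

  -- If u has a vertex s with λ(u,s) ≥ 3, contracting the edge uv and subdividing
  -- its partner uv′ would raise λ(s,v′).
  isolated-centre : ∀ {i j} → Partner G i j → ∀ {u v v′} → Joins (lookup G i) u v → Joins (lookup G j) u v′ →
    ∀ {s} → s ≢ u → ¬ (3 ≤ L u s)
  isolated-centre {i} {j} partner {u} {v} {v′} i-joins j-joins {s} s≢u 3≤L =
    PairMove.no-far-link opt partner i-joins j-joins s≢u s≢v (Joins-≢ {e = lookup G j} j-joins ∘ sym) v′≢v far link
    where
    open Partner partner
    near : ∀ {X} → cutSize G X ≤ 2 → X u ≡ X s
    near {X} X≤2 = decidable-stable (X u Bool.≟ X s) λ ≢ → <⇒≱ 3≤L (separated-≤2 opt X≤2 ≢)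
    s≢v : s ≢ v
    s≢v refl = let X , c , X≤2 = tight i in crosses⇒≢ {e = lookup G i} {X = X} i-joins c (near X≤2)
    v′≢v : v′ ≢ v
    v′≢v refl = not-parallel partner i-joins j-joins
    far : ∀ {X} → cutSize G X ≤ 2 → Crosses X (lookup G i) → X s ≢ X v′
    far {X} X≤2 c eq = crosses⇒≢ {e = lookup G j} {X = X} j-joins (to X≤2 c) (trans (near X≤2) eq)
    -- Such a cut either separates `u` from `s`, where λ(u,s) ≥ 3 applies, or separates `u` from
    -- `v′` and contains `j` without its partner `i`.
    link : ∀ Y → Y u ≡ Y v → Y s ≢ Y v′ → 3 ≤ cutSize G Y
    link Y Yu≡Yv Ys≢ with Y u Bool.≟ Y v′
    ... | yes Yu≡ = ≤-trans 3≤L (connected u s (s≢u ∘ sym) Y λ eq → Ys≢ (trans (sym eq) Yu≡))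
    ... | no Yu≢  = cut-one-≥3 partner {Y} (¬crosses {e = lookup G i} {X = Y} i-joins Yu≡Yv) (≢⇒crosses {e = lookup G j} {X = Y} j-joins Yu≢)

module _ {n} {G : Graph n} {L} (opt : Optimal G L) where

  open Optimal opt

  -- Once uv is contracted, λ(u,v′) ≥ 3, so isolated-centre applies to the
  -- second pair of edges at u.
  no-common-centre : ∀ {i j k l} → Partner G i j → Partner G k l → k ≢ i → k ≢ j →
    ∀ {u v v′ t t′} → Joins (lookup G i) u v → Joins (lookup G j) u v′ → Joins (lookup G k) u t → ¬ Joins (lookup G l) u t′
  no-common-centre {i} {j} {k} {l} ij kl k≢i k≢j {u} {v} {v′} {t} {t′} i-joins j-joins k-joins l-joins =
    localCuts-exist H conclude
    where
    open PairMove opt ij i-joins j-joins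
    Z = proj₁ (tight k)
    Z-k : Crosses Z (lookup G k)
    Z-k = proj₁ (proj₂ (tight k))
    Z≤2 = proj₂ (proj₂ (tight k))
    Z-l : Crosses Z (lookup G l)
    Z-l = Partner.to kl Z≤2 Z-k
    ¬Z-i : ¬ Crosses Z (lookup G i)
    ¬Z-i c = k≢j (Partner.only ij Z≤2 c Z-k k≢i)
    ¬Z-j : ¬ Crosses Z (lookup G j)
    ¬Z-j c = ¬Z-i (Partner.from ij Z≤2 c)
    Zu≡Zv = uncrossed⇒≡ {e = lookup G i} {X = Z} i-joins ¬Z-i
    Zu≢Zt = crosses⇒≢ {e = lookup G k} {X = Z} k-joins Z-k
    Zu≢Zt′ = crosses⇒≢ {e = lookup G l} {X = Z} l-joins Z-l
    l≢j : l ≢ j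
    l≢j refl = ¬Z-j Z-l
    merge-t : merge t ≡ t
    merge-t = merge-≢ λ where refl → Zu≢Zt Zu≡Zv
    merge-t′ : merge t′ ≡ t′
    merge-t′ = merge-≢ λ where refl → Zu≢Zt′ Zu≡Zv
    v′≢v : v′ ≢ v
    v′≢v refl = not-parallel ij i-joins j-joins
    v′≢u : v′ ≢ u
    v′≢u = Joins-≢ {e = lookup G j} j-joins ∘ sym
    linked : EdgeConnected H 3 u v′
    linked X X≢ = ≤-trans
      (cut-one-≥3 ij {X ∘ merge} (¬crosses {e = lookup G i} {X = X ∘ merge} i-joins (cong X (trans merge-u (sym merge-v))))
        (≢⇒crosses {e = lookup G j} {X = X ∘ merge} j-joins (subst₂ (λ x y → X x ≢ X y) (sym merge-u) (sym (merge-≢ v′≢v)) X≢)))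
      (cutSize-H-≥ X)
    k′ = preserved-edge {Z} {k} Zu≡Zv k-joins Zu≢Zt k≢j
    l′ = preserved-edge {Z} {l} Zu≡Zv l-joins Zu≢Zt′ l≢j
    k′-joins : Joins (lookup H (proj₁ k′)) u t
    k′-joins = subst₂ (Joins (lookup H (proj₁ k′))) merge-u merge-t (proj₂ k′)
    l′-joins : Joins (lookup H (proj₁ l′)) u t′
    l′-joins = subst₂ (Joins (lookup H (proj₁ l′))) merge-u merge-t′ (proj₂ l′)
    -- If the images coincided, `t` would equal `t′`, and the partners `k` and `l` would be
    -- parallel.
    l′≢k′ : proj₁ l′ ≢ proj₁ k′
    l′≢k′ eq = not-parallel kl k-joins (subst (Joins (lookup G l) u) (Joins-unique {e = lookup H (proj₁ k′)}
      (subst (λ m → Joins (lookup H m) u t′) eq l′-joins) k′-joins) l-joins)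
    conclude : ¬ (∃[ L′ ] LocalCuts H L′)
    -- `H` is optimal with λ(u,v′) ≥ 3, so the image of `k` has a partner there. The cut `Z`
    -- survives as a 2-edge cut `X` through the images of `k` and `l`, which identifies this partner
    -- as the image of `l`.
    conclude (L′ , cuts) = partner-exists (optimal-H cuts) (v′≢u ∘ sym) 3≤L′ (proj₁ k′) λ m k′m →
      isolated-centre′ m k′m (Partner.only k′m {X} X≤2 (X-crosses {proj₁ k′} k′-joins Zu≢Zt merge-t) (X-crosses {proj₁ l′} l′-joins Zu≢Zt′ merge-t′) l′≢k′)
      where
      3≤L′ : 3 ≤ L′ u v′
      3≤L′ = LocalCuts.greatest cuts u v′ (v′≢u ∘ sym) linked
      X = proj₁ (preserved-cut Z Zu≡Zv)
      X∘merge = proj₁ (proj₂ (preserved-cut Z Zu≡Zv))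
      X≤2 : cutSize H X ≤ 2
      X≤2 = subst (_≤ 2) (sym (proj₂ (proj₂ (preserved-cut Z Zu≡Zv)))) Z≤2
      X-crosses : ∀ {m t} → Joins (lookup H m) u t → Z u ≢ Z t → merge t ≡ t → Crosses X (lookup H m)
      X-crosses {m} {t} joins Zu≢Zt merge-t = ≢⇒crosses {e = lookup H m} {X = X} joins λ eq →
        Zu≢Zt (trans (sym (X∘merge u)) (trans (cong X merge-u) (trans eq (trans (cong X (sym merge-t)) (X∘merge t)))))
      isolated-centre′ : ∀ m → Partner H (proj₁ k′) m → proj₁ l′ ≡ m → ⊥
      isolated-centre′ m k′m refl = isolated-centre (optimal-H cuts) k′m k′-joins l′-joins v′≢u 3≤L′

  small-centre : ∀ {a b} → a ≢ b → 3 ≤ L a b → ∀ {i j} → Partner G i j →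
    ∀ {u v v′} → Joins (lookup G i) u v → Joins (lookup G j) u v′ → ¬ (3 ≤ cutSize G ⁅ u ⁆ᶜ)
  small-centre a≢b 3≤L {i} {j} ij {u} {v} {v′} i-joins j-joins 3≤d = third-crossing G ⁅ u ⁆ᶜ i j 3≤d third
    where
    third : ∀ k → k ≢ i → k ≢ j → ¬ Crosses ⁅ u ⁆ᶜ (lookup G k)
    third k k≢i k≢j c = partner-exists opt a≢b 3≤L k λ l kl → cases l kl (share-end opt kl k-joins)
      where
      t = proj₁ (crosses-⁅⁆⇒Joins (lookup G k) u c)
      k-joins = proj₂ (crosses-⁅⁆⇒Joins (lookup G k) u c)
      cases : ∀ l → Partner G k l → (∃[ t′ ] Joins (lookup G l) u t′) ⊎ (∃[ t′ ] Joins (lookup G l) t t′) → ⊥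
      cases l kl (inj₁ (t′ , l-joins)) = no-common-centre ij kl k≢i k≢j i-joins j-joins k-joins l-joins
      cases l kl (inj₂ (t′ , l-joins)) = isolated-centre opt ij i-joins j-joins t′≢u (greatest u t′ (t′≢u ∘ sym) linked)
        where
        t′≢u : t′ ≢ u
        t′≢u refl = not-parallel kl k-joins (Joins-sym {e = lookup G l} l-joins)
        -- Along the path u-t-t′ formed by `k` and `l`, a cut between `u` and `t′` contains exactly
        -- one of these two partners.
        linked : EdgeConnected G 3 u t′
        linked Y Yu≢Yt′ with Y u Bool.≟ Y t
        ... | yes Yu≡Yt = cut-one-≥3 kl {Y} (¬crosses {e = lookup G k} {X = Y} k-joins Yu≡Yt)
                            (≢⇒crosses {e = lookup G l} {X = Y} l-joins λ eq → Yu≢Yt′ (trans Yu≡Yt eq))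
        ... | no Yu≢Yt  = cut-other-≥3 kl {Y} (≢⇒crosses {e = lookup G k} {X = Y} k-joins Yu≢Yt)
                            (¬crosses {e = lookup G l} {X = Y} l-joins (≢-≢⇒≡ (Yu≢Yt ∘ sym) Yu≢Yt′))

-- A pair with λ at least 3, and the partition by degree

m≤∑ : ∀ {m} {f : Fin m → ℕ} → (∀ i → 1 ≤ f i) → m ≤ ∑ f
m≤∑ {zero}  1≤f = z≤n
m≤∑ {suc m} 1≤f = +-mono-≤ (1≤f zero) (m≤∑ (1≤f ∘ suc))

term≤∑ : ∀ {m} (f : Fin m → ℕ) i → f i ≤ ∑ f
term≤∑ f zero    = m≤m+n _ _
term≤∑ f (suc i) = m≤n⇒m≤o+n (f zero) (term≤∑ (f ∘ suc) i)

-- K₂,ₘ; for m ≥ 3 it beats every graph all of whose local edge-connectivities are 2.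
module DoubleStar (m : ℕ) where

  left right : Fin m → Edge (suc (suc m))
  left  i = record { end₁ = zero     ; end₂ = suc (suc i) ; noLoop = λ () }
  right i = record { end₁ = suc zero ; end₂ = suc (suc i) ; noLoop = λ () }

  spokes : List (Fin m) → Graph (suc (suc m))
  spokes []       = []
  spokes (i ∷ is) = left i ∷ right i ∷ spokes is

  doubleStar : Graph (suc (suc m))
  doubleStar = spokes (allFin m)

  through : Cut (suc (suc m)) → Fin m → ℕ
  through X i = separation X (left i) + separation X (right i)

  cutSize-doubleStar : ∀ X → cutSize doubleStar X ≡ ∑ (through X)
  cutSize-doubleStar X = tabulated id
    where
    tabulated : ∀ {k} (f : Fin k → Fin m) → cutSize (spokes (tabulate f)) X ≡ ∑ (through X ∘ f)
    tabulated {zero}  f = refl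
    tabulated {suc k} f = trans (sym (+-assoc (separation X (left (f zero))) _ _)) (cong (through X (f zero) +_) (tabulated (f ∘ suc)))

  spoke : ∀ is (k : Fin (length (spokes is))) → ∃[ i ] (lookup (spokes is) k ≡ left i ⊎ lookup (spokes is) k ≡ right i)
  spoke (i ∷ is) zero          = i , inj₁ refl
  spoke (i ∷ is) (suc zero)    = i , inj₂ refl
  spoke (i ∷ is) (suc (suc k)) = spoke is k

  hubs-connected : EdgeConnected doubleStar m zero (suc zero)
  hubs-connected X X≢ = subst (m ≤_) (sym (cutSize-doubleStar X)) (m≤∑ λ i → one i)
    where
    one : ∀ i → 1 ≤ through X i
    one i with X zero | X (suc zero) | X (suc (suc i))
    ... | true  | true  | _     = contradiction refl X≢
    ... | false | false | _     = contradiction refl X≢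
    ... | true  | false | true  = ≤-refl
    ... | true  | false | false = ≤-refl
    ... | false | true  | true  = ≤-refl
    ... | false | true  | false = ≤-refl

  doubleStar-minTwoEC : 2 ≤ m → MinTwoEC doubleStar
  doubleStar-minTwoEC 2≤m = record { twoEC = twoEC ; tight = λ k → tight k (spoke (allFin m) k) }
    where
    off-hubs : ∀ X → X zero ≡ X (suc zero) → ∀ x → X x ≢ X zero → 2 ≤ cutSize doubleStar X
    off-hubs X eq zero          x≢ = contradiction refl x≢
    off-hubs X eq (suc zero)    x≢ = contradiction (sym eq) x≢
    off-hubs X eq (suc (suc i)) x≢ = subst (2 ≤_) (sym (cutSize-doubleStar X)) (≤-trans
      (≤-reflexive (sym (cong₂ _+_ (sep-≢ (x≢ ∘ sym)) (sep-≢ λ e → x≢ (sym (trans eq e)))))) (term≤∑ (through X) i))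
    twoEC : ∀ X → Separates X → 2 ≤ cutSize doubleStar X
    twoEC X (x , y , x≢y) with X zero Bool.≟ X (suc zero)
    ... | no ≢   = ≤-trans 2≤m (hubs-connected X ≢)
    ... | yes eq with X x Bool.≟ X zero
    ...   | no x≢0  = off-hubs X eq x x≢0
    ...   | yes x≡0 = off-hubs X eq y λ y≡0 → x≢y (trans x≡0 (sym y≡0))
    leaf : Fin m → Cut (suc (suc m))
    leaf i = ⁅ suc (suc i) ⁆ᶜ
    leaf-i : ∀ i → leaf i (suc (suc i)) ≡ true
    leaf-i i = dec-true (suc (suc i) ≟ suc (suc i)) refl
    leaf≤2 : ∀ i → cutSize doubleStar (leaf i) ≤ 2
    leaf≤2 i = ≤-reflexive (trans (cutSize-doubleStar (leaf i)) (trans (sum-cong-≗ two) (∑-δ i 2)))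
      where
      two : ∀ j → through (leaf i) j ≡ δ i 2 j
      two j with does (j ≟ i)
      ... | true  = refl
      ... | false = refl
    tight : ∀ k → ∃[ i ] (lookup doubleStar k ≡ left i ⊎ lookup doubleStar k ≡ right i) →
      ∃[ X ] (Crosses X (lookup doubleStar k) × cutSize doubleStar X ≤ 2)
    tight k (i , inj₁ eq) = leaf i , subst (Crosses (leaf i)) (sym eq) (λ e → case trans e (leaf-i i) of λ ()) , leaf≤2 i
    tight k (i , inj₂ eq) = leaf i , subst (Crosses (leaf i)) (sym eq) (λ e → case trans e (leaf-i i) of λ ()) , leaf≤2 i

degree≡cutSize : ∀ {n} (G : Graph n) v → degree G v ≡ cutSize G ⁅ v ⁆ᶜ
degree≡cutSize []      v = refl
degree≡cutSize (e ∷ G) v with end₁ e ≟ v | end₂ e ≟ v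
... | yes eq₁ | yes eq₂ = contradiction (trans eq₁ (sym eq₂)) (noLoop e)
... | yes _   | no _    = cong suc (degree≡cutSize G v)
... | no _    | yes _   = cong suc (degree≡cutSize G v)
... | no _    | no _    = degree≡cutSize G v

module _ {m} {G : Graph (suc (suc m))} {L} (opt : Optimal G L) (3≤m : 3 ≤ m) {i j : Fin m} (i≢j : i ≢ j) where

  open Optimal opt
  open DoubleStar m

  linked-pair : ¬ (∀ a b → a ≢ b → ¬ (3 ≤ L a b))
  linked-pair none = localCuts-exist doubleStar improved
    where
    star : MinTwoEC doubleStar
    star = doubleStar-minTwoEC (≤-trans (n≤1+n 2) 3≤m)
    ≤2 : ∀ a b → a ≢ b → L a b ≤ 2
    ≤2 a b a≢b = ≮⇒≥ (none a b a≢b)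
    improved : ¬ (∃[ L′ ] LocalCuts doubleStar L′)
    improved (L′ , cuts) = <⇒≱ larger (best doubleStar star L′ cuts)
      where
      open LocalCuts cuts using () renaming (greatest to greatest′; symmetric to symmetric′)
      L≤L′ : ∀ a b → a ≢ b → L a b ≤ L′ a b
      L≤L′ a b a≢b = ≤-trans (≤2 a b a≢b) (greatest′ a b a≢b λ X X≢ → MinTwoEC.twoEC star X (a , b , X≢))
      -- This is where the order at least 5 enters: the hubs are joined by m = n - 2 ≥ 3
      -- edge-disjoint paths.
      hubs : L zero (suc zero) < L′ zero (suc zero)
      hubs = ≤-trans (s≤s (≤2 zero (suc zero) λ ())) (greatest′ zero (suc zero) (λ ()) λ X X≢ → ≤-trans 3≤m (hubs-connected X X≢))
      -- No vertex is exceptional here. Two leaves fill the exceptional places of `Compare`, which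
      -- leaves the strict gain between the hubs away from them.
      u v : Fin (suc (suc m))
      u = suc (suc i)
      v = suc (suc j)
      u≢v : u ≢ v
      u≢v eq = i≢j (Fin-suc-injective (Fin-suc-injective eq))
      larger : total L < total L′
      larger = Compare.total-<-away symmetric symmetric′ u≢v
        (λ a b a≢b _ _ _ _ → L≤L′ a b a≢b) (λ a a≢u a≢v → +-mono-≤ (L≤L′ a u a≢u) (L≤L′ a v a≢v)) (L≤L′ u v u≢v)
        zero (suc zero) (λ ()) (λ ()) (λ ()) (λ ()) (λ ()) hubs

module _ {n} {G : Graph n} {L} (opt : Optimal G L) {a b} (a≢b : a ≢ b) (3≤L : 3 ≤ L a b) where

  open Optimal opt

  degree≥2 : ∀ {u v} → u ≢ v → 2 ≤ cutSize G ⁅ u ⁆ᶜ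
  degree≥2 {u} {v} u≢v = twoEC ⁅ u ⁆ᶜ (u , v , ⁅⁆-separates u≢v)

  not-both-large : ∀ {i u v} → Joins (lookup G i) u v → 3 ≤ cutSize G ⁅ u ⁆ᶜ → ¬ (3 ≤ cutSize G ⁅ v ⁆ᶜ)
  not-both-large {i} {u} {v} joins 3≤u 3≤v = partner-exists opt a≢b 3≤L i λ j partner →
    cases partner (share-end opt partner joins)
    where
    cases : ∀ {j} → Partner G i j → (∃[ w ] Joins (lookup G j) u w) ⊎ (∃[ w ] Joins (lookup G j) v w) → ⊥
    cases partner (inj₁ (w , j-joins)) = small-centre opt a≢b 3≤L partner joins j-joins 3≤u
    cases partner (inj₂ (w , j-joins)) = small-centre opt a≢b 3≤L partner (Joins-sym {e = lookup G i} joins) j-joins 3≤v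

  -- The edges at a vertex of degree 2 form a 2-edge cut, so the partner of an edge meets each of
  -- its ends of degree 2. With two such ends the partners would be parallel.
  not-both-two : ∀ {i u v} → Joins (lookup G i) u v → cutSize G ⁅ u ⁆ᶜ ≤ 2 → ¬ (cutSize G ⁅ v ⁆ᶜ ≤ 2)
  not-both-two {i} {u} {v} joins u≤2 v≤2 = partner-exists opt a≢b 3≤L i λ j partner →
    let open Partner partner
        u≢v = Joins-≢ {e = lookup G i} joins
        at-u = crosses-⁅⁆⇒Joins (lookup G j) u (to u≤2 (≢⇒crosses {e = lookup G i} {X = ⁅ u ⁆ᶜ} joins (⁅⁆-separates u≢v)))
        at-v = crosses-⁅⁆⇒Joins (lookup G j) v (to v≤2 (≢⇒crosses {e = lookup G i} {X = ⁅ v ⁆ᶜ} joins (⁅⁆-separates (u≢v ∘ sym) ∘ sym)))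
    in not-parallel partner joins (Joins-both {e = lookup G j} u≢v (proj₂ at-u) (proj₂ at-v))

corollary3p10 : (n : ℕ) → 5 ≤ n → (G : Graph n) → EdgeOptimal G →
    BipartiteWithPartiteSets G (λ v → degree G v ≡ 2) (λ v → 2 < degree G v)
corollary3p10 (suc (suc m)) (s≤s (s≤s 3≤m)) G edge-optimal = record
  { covers   = λ v → [ inj₂ , inj₁ ∘ sym ]′ (two-or-more v)
  ; disjoint = λ v (d≡2 , 2<d) → <⇒≢ 2<d (sym d≡2)
  ; crossing = λ e e∈G → classify (two-or-more (end₁ e)) (two-or-more (end₂ e)) (index e∈G)
                           (subst (λ g → Joins g (end₁ e) (end₂ e)) (lookup-index e∈G) (inj₁ (refl , refl)))
  }
  where
  two-leaves : ∀ {m} → 3 ≤ m → Σ[ i ∈ Fin m ] Σ[ j ∈ Fin m ] i ≢ j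
  two-leaves (s≤s (s≤s _)) = zero , suc zero , λ ()

  -- The values of λ and the pair with λ ≥ 3 are available only up to double negation; each use ends
  -- in a decidable inequality or in a contradiction.
  with-link : ∀ {A : Set} → (∀ {L} → Optimal G L → ∀ {a b} → a ≢ b → 3 ≤ L a b → A) → ¬ ¬ A
  with-link f ¬A = fromEdgeOptimal edge-optimal λ (L , opt) →
    linked-pair opt 3≤m (proj₂ (proj₂ (two-leaves 3≤m))) λ a b a≢b 3≤L → ¬A (f opt a≢b 3≤L)

  another : ∀ (v : Fin (suc (suc m))) → ∃[ w ] v ≢ w
  another zero    = suc zero , λ ()
  another (suc v) = zero , λ ()

  two-or-more : ∀ v → 2 < degree G v ⊎ 2 ≡ degree G v
  two-or-more v = m≤n⇒m<n∨m≡n (decidable-stable (2 ≤? degree G v) (with-link λ opt a≢b 3≤L →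
    subst (2 ≤_) (sym (degree≡cutSize G v)) (degree≥2 opt a≢b 3≤L (proj₂ (another v)))))

  classify : ∀ {u v} → 2 < degree G u ⊎ 2 ≡ degree G u → 2 < degree G v ⊎ 2 ≡ degree G v →
    ∀ i → Joins (lookup G i) u v → (degree G u ≡ 2 × 2 < degree G v) ⊎ (2 < degree G u × degree G v ≡ 2)
  classify (inj₂ 2≡) (inj₁ 2<) _ _ = inj₁ (sym 2≡ , 2<)
  classify (inj₁ 2<) (inj₂ 2≡) _ _ = inj₂ (2< , sym 2≡)
  classify {u} {v} (inj₁ 2<u) (inj₁ 2<v) i joins = contradiction id (with-link λ opt a≢b 3≤L →
    not-both-large opt a≢b 3≤L {i} joins (subst (2 <_) (degree≡cutSize G u) 2<u) (subst (2 <_) (degree≡cutSize G v) 2<v))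
  classify {u} {v} (inj₂ 2≡u) (inj₂ 2≡v) i joins = contradiction id (with-link λ opt a≢b 3≤L →
    not-both-two opt a≢b 3≤L {i} joins (≤-reflexive (sym (trans 2≡u (degree≡cutSize G u)))) (≤-reflexive (sym (trans 2≡v (degree≡cutSize G v)))))
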